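{- Let $\mathbb{A}\subseteq \mathbb{R}\times E^{[\infty]}$ be analytic. Then there are a nonempty perfect set $P\subseteq\mathbb{R}$ and an $X\in E^{[\infty]}$ such that either (i) player I has a strategy $\sigma$ in the asymptotic game $F[X]$ such that $P\times[\sigma]\subseteq(\mathbb{R}\times E^{[\infty]})\setminus\mathbb{A}$, or (ii) for every $t\in P$, player II has a strategy in the Gowers game $G[X]$ for playing into $\mathbb{A}_t=\{Y\in E^{[\infty]}:(t,Y)\in\mathbb{A}\}$.
   Context: $F$ is a countable (possibly finite) field and $E$ is a countably infinite-dimensional $F$-vector space with a fixed basis $(e_n)_{n\in\omega}$. The support $\mathrm{supp}(v)$ of a nonzero $v\in E$ is the finite set of $i$ such that $e_i$ has nonzero coefficient in $v$. A block sequence is a sequence $(x_n)$ of nonzero vectors with $\max\mathrm{supp}(x_n)<\min\mathrm{supp}(x_{n+1})$ for all $n$. $E^{[\infty]}$ is the set of infinite block sequences, topologized as a subspace of $E^\omega$ ($E$ discrete), a Polish space. $\langle X\rangle$ is the linear span of $X$; $Y\preceq X$ means $\langle Y\rangle\subseteq\langle X\rangle$. Asymptotic game $F[X]$ ($X\in E^{[\infty]}$): I plays natural numbers $n_k$, II responds with nonzero $y_k\in\langle X\rangle$ with $n_k<\min\mathrm{supp}(y_k)$, and II's moves must form a block sequence; the outcome is $(y_k)$. Gowers game $G[X]$: I plays $Y_k\in E^{[\infty]}$ with $Y_k\preceq X$, II responds with nonzero $y_k\in\langle Y_k\rangle$, II's moves forming a block sequence; outcome $(y_k)$. A strategy for a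 player is a function from finite sequences of the opponent's previous moves to moves. A player has a strategy for playing into (out of) a set $\mathbb{B}\subseteq E^{[\infty]}$ if all outcomes of plays following the strategy lie in (outside) $\mathbb{B}$. For a strategy $\sigma$ of I, $[\sigma]$ is the set of all outcomes of plays in which I follows $\sigma$. -}

module Defs where

open import Level using (0ℓ)
open import Algebra.Bundles using (CommutativeRing)
open import Algebra.Module.Bundles using (Module)
open import Data.Integer.Base using (+_)
open import Data.List.Base using (List; []; _∷_; applyUpTo)
open import Data.List.Relation.Binary.Equality.Setoid using (≋-setoid)
open import Data.List.Relation.Unary.All using (All)
open import Data.Nat.Base as ℕ using (ℕ; zero)
open import Data.Product.Base using (Σ-syntax; ∃-syntax; _×_; _,_; proj₁)
open import Data.Rational.Base as ℚ using (ℚ; 0ℚ)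
open import Data.Sum.Base using (_⊎_)
open import Function.Base using (_∘_)
open import Function.Bundles using (Func; Surjection; _⇔_)
open import Relation.Binary.Bundles using (Setoid)
open import Relation.Binary.PropositionalEquality as ≡ using (_≡_)
open import Relation.Nullary.Negation using (¬_)
open import Relation.Unary using (Pred; Empty; _⊆_)

------------------------------------------------------------------------
-- Topology

-- A space is presented by a countable base of a Hausdorff uniformity:
-- the sets `Near n z` (n ∈ ℕ) are a neighbourhood base at z, decreasing
-- in n, and points are identified when they are `Near n` for all n.  The
-- laws are not recorded; only the four concrete spaces below are used.

record Space : Set₁ where
  field
    Carrier : Set
    Near    : ℕ → Carrier → Carrier → Set

  infix 4 _∼_
  _∼_ : Carrier → Carrier → Set
  z ∼ w = ∀ n → Near n z w

_×ₛ_ : Space → Space → Space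
S ×ₛ T = record
  { Carrier = S.Carrier × T.Carrier
  ; Near    = λ { n (s , t) (s′ , t′) → S.Near n s s′ × T.Near n t t′ }
  }
  where
  module S = Space S
  module T = Space T

Continuous : (S T : Space) → (Space.Carrier S → Space.Carrier T) → Set
Continuous S T f =
  ∀ z n → ∃[ k ] (∀ w → S.Near k z w → T.Near n (f z) (f w))
  where
  module S = Space S
  module T = Space T

Baire : Space
Baire = record
  { Carrier = ℕ → ℕ
  ; Near    = λ n α β → ∀ i → i ℕ.< n → α i ≡ β i
  }

module _ (S : Space) where
  open Space S

  -- C contains every point of its closure.
  Closed : Pred Carrier 0ℓ → Set
  Closed C = ∀ z → (∀ n → ∃[ w ] (C w × Near n z w)) → C z

  NoIsolatedPoints : Pred Carrier 0ℓ → Set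
  NoIsolatedPoints P =
    ∀ z → P z → ∀ n → ∃[ w ] (P w × Near n z w × ¬ (z ∼ w))

  Perfect : Pred Carrier 0ℓ → Set
  Perfect P = Closed P × NoIsolatedPoints P

  -- Empty, or a continuous image of Baire space.  In particular an
  -- analytic predicate respects _∼_.
  Analytic : Pred Carrier 0ℓ → Set
  Analytic A =
    Empty A ⊎
    (Σ[ f ∈ ((ℕ → ℕ) → Carrier) ]
      (Continuous Baire S f × (∀ z → A z ⇔ (∃[ α ] (f α ∼ z)))))

------------------------------------------------------------------------
-- The real line

record ℝ : Set where
  field
    approx : ℕ → ℚ
    cauchy : ∀ ε → 0ℚ ℚ.< ε → ∃[ N ] (∀ m n → N ℕ.≤ m → N ℕ.≤ n →
               ℚ.∣ approx m ℚ.- approx n ∣ ℚ.< ε)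

open ℝ

-- The distance of the limits of two Cauchy sequences is less than q.
dist_,_<_ : ℝ → ℝ → ℚ → Set
dist x , y < q =
  ∃[ δ ] (δ ℚ.< q ×
    ∃[ N ] (∀ m → N ℕ.≤ m → ℚ.∣ approx x m ℚ.- approx y m ∣ ℚ.≤ δ))

-- The induced identification _∼_ is equality of limits.
ℝ-space : Space
ℝ-space = record
  { Carrier = ℝ
  ; Near    = λ n x y → dist x , y < (+ 1 ℚ./ ℕ.suc n)
  }

------------------------------------------------------------------------
-- Countable fields and bases

record IsField (F : CommutativeRing 0ℓ 0ℓ) : Set where
  open CommutativeRing F
  field
    nontrivial : ¬ (0# ≈ 1#)
    inverse    : ∀ a → ¬ (a ≈ 0#) → ∃[ b ] (a * b ≈ 1#)

-- Countable, possibly finite.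
Countable : CommutativeRing 0ℓ 0ℓ → Set
Countable F = Surjection (≡.setoid ℕ) (CommutativeRing.setoid F)

module _ {F : CommutativeRing 0ℓ 0ℓ} (E : Module F 0ℓ 0ℓ) where
  open CommutativeRing F using (Carrier; _≈_; 0#)
  open Module E

  -- Σ aᵢ xᵢ for i below the length of the coefficient list.
  combination : (ℕ → Carrierᴹ) → List Carrier → Carrierᴹ
  combination x []       = 0ᴹ
  combination x (a ∷ as) = (a *ₗ x 0) +ᴹ combination (x ∘ ℕ.suc) as

  Span : (ℕ → Carrierᴹ) → Pred Carrierᴹ 0ℓ
  Span x v = ∃[ as ] (combination x as ≈ᴹ v)

  record IsBasis (e : ℕ → Carrierᴹ) : Set where
    field
      independent : ∀ as → combination e as ≈ᴹ 0ᴹ → All (_≈ 0#) as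
      spanning    : ∀ v → Span e v

------------------------------------------------------------------------
-- Block sequences and games

module BlockSequences
  {F : CommutativeRing 0ℓ 0ℓ} (E : Module F 0ℓ 0ℓ)
  {e : ℕ → Module.Carrierᴹ E} (basis : IsBasis E e) where

  open CommutativeRing F using (Carrier; _≈_; 0#)
  open Module E
  open IsBasis basis

  -- The i-th entry, or 0 beyond the end of the list.
  entry : List Carrier → ℕ → Carrier
  entry []       i         = 0#
  entry (a ∷ as) zero      = a
  entry (a ∷ as) (ℕ.suc i) = entry as i

  -- Independent, up to _≈_, of the chosen expansion of v.
  coefficient : Carrierᴹ → ℕ → Carrier
  coefficient v = entry (proj₁ (spanning v))

  supp : Carrierᴹ → Pred ℕ 0ℓ
  supp v i = ¬ (coefficient v i ≈ 0#)

  -- n < min supp(v)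
  _<min-supp_ : ℕ → Carrierᴹ → Set
  n <min-supp v = ∀ i → supp v i → n ℕ.< i

  -- max supp(v) < min supp(w)
  _<ˢ_ : Carrierᴹ → Carrierᴹ → Set
  v <ˢ w = ∀ i → supp v i → i <min-supp w

  record E^[∞] : Set where
    field
      term    : ℕ → Carrierᴹ
      nonzero : ∀ n → ¬ (term n ≈ᴹ 0ᴹ)
      block   : ∀ n → term n <ˢ term (ℕ.suc n)

  open E^[∞] public

  E^[∞]-space : Space
  E^[∞]-space = record
    { Carrier = E^[∞]
    ; Near    = λ n X Y → ∀ i → i ℕ.< n → term X i ≈ᴹ term Y i
    }

  E^[∞]-setoid : Setoid 0ℓ 0ℓ
  E^[∞]-setoid = record
    { Carrier       = E^[∞]
    ; _≈_           = λ X Y → ∀ n → term X n ≈ᴹ term Y n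
    ; isEquivalence = record
      { refl  = λ n → ≈ᴹ-refl
      ; sym   = λ p n → ≈ᴹ-sym (p n)
      ; trans = λ p q n → ≈ᴹ-trans (p n) (q n)
      }
    }

  ⟨_⟩ : E^[∞] → Pred Carrierᴹ 0ℓ
  ⟨ X ⟩ = Span E (term X)

  _⪯_ : E^[∞] → E^[∞] → Set
  Y ⪯ X = ⟨ Y ⟩ ⊆ ⟨ X ⟩

  -- A strategy for I in the asymptotic game answers y₀,…,yₖ₋₁ with nₖ.
  StrategyI : Set
  StrategyI = Func (≋-setoid ≈ᴹ-setoid) (≡.setoid ℕ)

  -- [ σ ] X is the set of outcomes of plays of F[X] in which I follows σ.
  [_] : StrategyI → E^[∞] → Pred E^[∞] 0ℓ
  [ σ ] X Y =
    ∀ k → ⟨ X ⟩ (term Y k) ×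
          (Func.to σ (applyUpTo (term Y) k) <min-supp term Y k)

  -- A strategy for II in the Gowers game answers Y₀,…,Yₖ with yₖ.
  StrategyII : Set
  StrategyII = Func (≋-setoid E^[∞]-setoid) ≈ᴹ-setoid

  -- Against every play Y₀, Y₁, … of I in G[X], the answers given by τ are
  -- legal moves and their sequence is a member Z of 𝔹.
  PlaysInto : E^[∞] → StrategyII → Pred E^[∞] 0ℓ → Set
  PlaysInto X τ 𝔹 =
    ∀ (Y : ℕ → E^[∞]) → (∀ k → Y k ⪯ X) →
    ∃[ Z ] ((∀ k → term Z k ≈ᴹ Func.to τ (applyUpTo Y (ℕ.suc k))) ×
            (∀ k → ⟨ Y k ⟩ (term Z k)) ×
            𝔹 Z)

{-# OPTIONS --safe #-}
module Submission where

-- Conditions are pairs (g , X) of a perfect tree g of parameters and a block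
-- sequence X.  By fusion, countably many open dense sets of conditions can be
-- met at all sufficiently deep nodes of one tree, together with one X.
--
-- For a finite history s of II's moves and a finite initial segment α of a
-- Baire witness, call (s , α) avoidable below (g , X) if I has a strategy in
-- F[X] continuing s, uniform over g, such that no outcome is hit by a witness
-- extending α.  Decide avoidability of all (s , α) by fusion.  If ([] , []) is
-- unavoidable, consider for each unavoidable (s , α) the open game in which II
-- tries to extend s so that some (r , a ∷ α) is unavoidable.  If I could
-- prevent this throughout a condition, I would combine the strategies for all
-- the digits a, phasing them in one after the other, and avoid (s , α).  Hence
-- II reaches such a position in the Gowers game for each parameter; iterating,
-- II produces an outcome together with a witness for it.
--
-- The pigeonhole principle behind the open game: either every subspace meets
-- the bad vectors, at all parameters of some condition, or a single subspace
-- avoids them over a perfect tree.  The latter subspace is built one vector at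
-- a time, keeping every finite span compatible with a parameter below each node.

open import Defs
open import Level using (0ℓ)
open import Algebra.Bundles using (CommutativeRing)
open import Algebra.Module.Bundles using (Module)
import Algebra.Properties.Ring as RingProperties
open import Axiom.ExcludedMiddle using (ExcludedMiddle)
open import Data.Bool.Base using (Bool; true; false; not)
open import Data.Bool.Properties using (not-¬) renaming (_≟_ to _≟ᵇ_)
open import Data.Empty using (⊥; ⊥-elim)
import Data.Integer.Base as ℤ
open import Data.List.Base using (List; []; _∷_; _++_; length; map; reverse; applyUpTo)
open import Data.List.Properties
  using (∷-injective; ∷-injectiveʳ; ++-assoc; ++-identityʳ; length-++; reverse-++; applyUpTo-∷ʳ; map-applyUpTo)
open import Data.List.Relation.Binary.Pointwise.Base using (Pointwise; []; _∷_)
open import Data.List.Relation.Unary.All using (All; []; _∷_)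
open import Data.Maybe.Base using (Maybe; just; nothing)
open import Data.Nat.Base as ℕ using (ℕ; zero; suc; z≤n; s≤s)
import Data.Nat.Properties as ℕₚ
open import Data.Product.Base using (Σ; Σ-syntax; ∃-syntax; _×_; _,_; proj₁; proj₂)
import Data.Rational.Base as ℚ
open import Data.Rational.Solver using (module +-*-Solver)
import Data.Rational.Unnormalised.Base as ℚᵘ
import Data.Rational.Unnormalised.Properties as ℚᵘₚ
open import Data.Sum.Base using (_⊎_; inj₁; inj₂)
open import Function.Base using (_∘_; id)
open import Function.Bundles using (Func; module Surjection; module Equivalence)
import Relation.Binary.Reasoning.Setoid as SetoidReasoning
open import Relation.Binary.PropositionalEquality as ≡ using (_≡_)
open import Relation.Nullary using (¬_; yes; no)
open import Relation.Unary using (Pred; Satisfiable; _⊆_)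

-- Over a general field, a set of vectors and its complement may both meet every block subspace. The
-- only dichotomy left is that some subspace misses the set or that every subspace meets it. This
-- explains the two games: when a subspace misses the set, I only has to push II far enough out;
-- when every subspace meets it, II can answer any subspace. The parameter makes even this dichotomy
-- nontrivial. If the set is not always met, one obtains one subspace and one point of the tree at
-- which it is missed, while (i) wants a single strategy for all of `P`. What helps is that the sets
-- of parameters involved are open: badness at a node passes to everything beyond it, so a good
-- point below each node excludes badness at all nodes. The coded games do not require II's moves to
-- be nonzero or to form a block sequence. An outcome that is hit is a block sequence in any case,
-- being the code of a member of `E^[∞]`. Countability of the field makes the positions countable,
-- so that all of them can be decided by one fusion.

module Combinatorics where
  open import Data.Nat.Base using (_+_; _∸_; _⊔_; _≤_; _<_)
  open import Data.Nat.Properties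
  open import Relation.Binary.PropositionalEquality

  -- Finite sequences and limits of chains

  private variable A : Set

  -- Finite sequences are stored with the most recent entry first.
  infix 4 _⊒_
  _⊒_ : List A → List A → Set
  v ⊒ u = ∃[ w ] (v ≡ w ++ u)

  ⊒-refl : {u : List A} → u ⊒ u
  ⊒-refl = [] , refl

  ⊒-++ : (w : List A) {u : List A} → w ++ u ⊒ u
  ⊒-++ w = w , refl

  ⊒-reflexive : {v u : List A} → v ≡ u → v ⊒ u
  ⊒-reflexive e = [] , e

  ⊒-trans : {w v u : List A} → w ⊒ v → v ⊒ u → w ⊒ u
  ⊒-trans {u = u} (x , e) (y , f) = x ++ y ,
    trans e (trans (cong (x ++_) f) (sym (++-assoc x y u)))

  ⊒-length : {v u : List A} → v ⊒ u → length u ≤ length v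
  ⊒-length {u = u} (w , refl) =
    subst (length u ≤_) (sym (length-++ w)) (m≤n+m (length u) (length w))

  hist : (ℕ → A) → ℕ → List A
  hist f zero    = []
  hist f (suc n) = f n ∷ hist f n

  shift : ℕ → (ℕ → A) → ℕ → A
  shift n f k = f (k + n)

  hist-length : (f : ℕ → A) (n : ℕ) → length (hist f n) ≡ n
  hist-length f zero    = refl
  hist-length f (suc n) = cong suc (hist-length f n)

  hist-++-length : (f : ℕ → A) (n : ℕ) {u : List A} → n ≤ length (hist f n ++ u)
  hist-++-length f zero    = z≤n
  hist-++-length f (suc n) = s≤s (hist-++-length f n)

  splitAt-suffix : (n : ℕ) (w : List A) → n ≤ length w → ∃[ u ] (length u ≡ n × w ⊒ u)
  splitAt-suffix n w n≤w with m≤n⇒m<n∨m≡n n≤w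
  splitAt-suffix n w       _ | inj₂ refl      = w , refl , ⊒-refl
  splitAt-suffix n (a ∷ w) _ | inj₁ (s≤s n≤w) =
    let (u , eq , w⊒u) = splitAt-suffix n w n≤w in u , eq , ⊒-trans (⊒-++ (a ∷ [])) w⊒u

  hist-cong : {f g : ℕ → A} (n : ℕ) → (∀ i → i < n → f i ≡ g i) → hist f n ≡ hist g n
  hist-cong zero    eq = refl
  hist-cong (suc n) eq = cong₂ _∷_ (eq n ≤-refl) (hist-cong n λ i i<n → eq i (m<n⇒m<1+n i<n))

  hist-injective : {f g : ℕ → A} (n : ℕ) → hist f n ≡ hist g n → ∀ i → i < n → f i ≡ g i
  hist-injective (suc n) eq i i<1+n with m≤n⇒m<n∨m≡n i<1+n
  ... | inj₁ (s≤s i<n) = hist-injective n (∷-injectiveʳ eq) i i<n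
  ... | inj₂ refl      = proj₁ (∷-injective eq)

  hist-+ : (f : ℕ → A) (k n : ℕ) → hist f (k + n) ≡ hist (shift n f) k ++ hist f n
  hist-+ f zero    n = refl
  hist-+ f (suc k) n = cong (f (k + n) ∷_) (hist-+ f k n)

  hist-mono : (f : ℕ → A) {m n : ℕ} → m ≤ n → hist f n ⊒ hist f m
  hist-mono f {m} {n} m≤n = hist (shift m f) (n ∸ m) ,
    trans (cong (hist f) (sym (m∸n+n≡m m≤n))) (hist-+ f (n ∸ m) m)

  hist-suffix : {f : ℕ → A} (m : ℕ) {u : List A} → hist f m ⊒ u → hist f (length u) ≡ u
  hist-suffix {f = f} m ([] , refl) = cong (hist f) (hist-length f m)
  hist-suffix (suc m) (a ∷ w , eq) = hist-suffix m (w , ∷-injectiveʳ eq)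

  hist-restrict : {f g : ℕ → A} {m n : ℕ} → m ≤ n → hist f n ≡ hist g n → hist f m ≡ hist g m
  hist-restrict {n = n} m≤n eq =
    hist-cong _ λ i i<m → hist-injective n eq i (<-≤-trans i<m m≤n)

  module Limit {A : Set} (default : A) where

    -- Positions are counted from the oldest entry, so prolonging a word leaves earlier values
    -- unchanged; `default` fills the places beyond its end.
    at : List A → ℕ → A
    at []      i = default
    at (a ∷ w) i with i ≟ length w
    ... | yes _ = a
    ... | no  _ = at w i

    at-++ : (w u : List A) {i : ℕ} → i < length u → at (w ++ u) i ≡ at u i
    at-++ []      u i<u = refl
    at-++ (a ∷ w) u {i} i<u with i ≟ length (w ++ u)
    ... | no  _    = at-++ w u i<u
    ... | yes refl = ⊥-elim (<⇒≱ i<u (⊒-length (⊒-++ w)))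

    hist-at : (w : List A) → hist (at w) (length w) ≡ w
    hist-at []      = refl
    hist-at (a ∷ w) = cong₂ _∷_ top
      (trans (hist-cong (length w) λ i i<w → at-++ (a ∷ []) w i<w) (hist-at w))
      where
      top : at (a ∷ w) (length w) ≡ a
      top with length w ≟ length w
      ... | yes _ = refl
      ... | no ne = ⊥-elim (ne refl)

    module Along (a : ℕ → List A) (grow : ∀ k → a (suc k) ⊒ a k)
             (long : ∀ n → ∃[ k ] (n ≤ length (a k))) where

      monotone : ∀ j {k} → a (j + k) ⊒ a k
      monotone zero    = ⊒-refl
      monotone (suc j) = ⊒-trans (grow (j + _)) (monotone j)

      monotone-≤ : ∀ {j k} → j ≤ k → a k ⊒ a j
      monotone-≤ {j} {k} j≤k = subst (λ m → a m ⊒ a j) (m∸n+n≡m j≤k) (monotone (k ∸ j))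

      limit : ℕ → A
      limit i = at (a (proj₁ (long (suc i)))) i

      agree : ∀ {i k l} → i < length (a k) → i < length (a l) → at (a k) i ≡ at (a l) i
      agree {i} {k} {l} i<k i<l with ≤-total k l
      ... | inj₁ k≤l = let (w , e) = monotone-≤ k≤l in
                       sym (trans (cong (λ v → at v i) e) (at-++ w (a k) i<k))
      ... | inj₂ l≤k = let (w , e) = monotone-≤ l≤k in
                       trans (cong (λ v → at v i) e) (at-++ w (a l) i<l)

      hist-limit : ∀ k → hist limit (length (a k)) ≡ a k
      hist-limit k = trans
        (hist-cong (length (a k)) λ i i<k → agree (proj₂ (long (suc i))) i<k)
        (hist-at (a k))

  -- Perfect trees and their branches

  Word : Set
  Word = List Bool

  Pt : Set
  Pt = ℕ → Bool

  -- A perfect tree is given by an order embedding of the full binary tree.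
  record Tree : Set where
    constructor tree
    infixr 10 _·_
    field
      _·_  : Word → Word
      grow : ∀ b u → _·_ (b ∷ u) ⊒ b ∷ _·_ u

  open Tree public

  ·-mono : (g : Tree) (w : Word) {u : Word} → g · (w ++ u) ⊒ g · u
  ·-mono g []      = ⊒-refl
  ·-mono g (b ∷ w) = ⊒-trans (grow g b (w ++ _)) (⊒-trans (⊒-++ (b ∷ [])) (·-mono g w))

  ·-⊒ : (g : Tree) {v u : Word} → v ⊒ u → g · v ⊒ g · u
  ·-⊒ g (w , refl) = ·-mono g w

  ·-length : (g : Tree) (u : Word) → length u ≤ length (g · u)
  ·-length g []      = z≤n
  ·-length g (b ∷ u) = ≤-trans (s≤s (·-length g u)) (⊒-length (grow g b u))

  idᵗ : Tree
  idᵗ = tree id λ b u → ⊒-refl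

  cone : Word → Tree
  cone u = tree (_++ u) λ b w → ⊒-refl

  -- A maximum over the finitely many words of length `n`. It turns bounds that depend on the node
  -- into one number that I can play for all parameters at once.
  uniform-bound : ∀ n {Q : Word → ℕ → Set} → (∀ {u i j} → i ≤ j → Q u i → Q u j) →
                  (∀ u → length u ≡ n → ∃[ i ] Q u i) → ∃[ i ] (∀ u → length u ≡ n → Q u i)
  uniform-bound zero mono bounds with bounds [] refl
  ... | i , q = i , λ { [] _ → q }
  uniform-bound (suc n) mono bounds
    with uniform-bound n mono (λ u e → bounds (false ∷ u) (cong suc e))
       | uniform-bound n mono (λ u e → bounds (true ∷ u) (cong suc e))
  ... | i , p | j , q = i ⊔ j , λ
    { (false ∷ u) e → mono (m≤m⊔n i j) (p u (suc-injective e))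
    ; (true ∷ u)  e → mono (m≤n⊔m i j) (q u (suc-injective e)) }

  infixr 9 _∙_
  _∙_ : Tree → Tree → Tree
  g ∙ h = tree (λ u → g · h · u) λ b u →
    ⊒-trans (·-⊒ g (grow h b u)) (grow g b (h · u))

  infix 4 _⊑_
  -- Keeping the factor makes the order usable on branches: branch `y` of `g′` is branch
  -- `lim factor y` of `g`, so statements about all branches of `g` pass to `g′`.
  record _⊑_ (g′ g : Tree) : Set where
    constructor via
    field
      factor  : Tree
      factors : ∀ u → g′ · u ≡ g · factor · u

  open _⊑_ public

  ⊑-refl : ∀ {g} → g ⊑ g
  ⊑-refl = via idᵗ λ u → refl

  ⊑-trans : ∀ {f g h} → f ⊑ g → g ⊑ h → f ⊑ h
  ⊑-trans (via k e) (via l e′) = via (l ∙ k) λ u → trans (e u) (e′ (k · u))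

  ∙-⊑ : ∀ g h → g ∙ h ⊑ g
  ∙-⊑ g h = via h λ u → refl

  ∙-⊑-∙ : ∀ g {h k} → h ⊑ k → g ∙ h ⊑ g ∙ k
  ∙-⊑-∙ g (via l e) = via l λ u → cong (g ·_) (e u)

  cone-⊑-cone : ∀ {v u} → v ⊒ u → cone v ⊑ cone u
  cone-⊑-cone {u = u} (w , refl) = via (cone w) λ x → sym (++-assoc x w u)

  ∙-cone-⊑ : ∀ g u → g ∙ cone u ⊑ cone (g · u)
  ∙-cone-⊑ g u = via (tree (λ w → proj₁ (·-mono g w {u})) grow′)
    λ w → proj₂ (·-mono g w)
    where
    grow′ : ∀ b w → proj₁ (·-mono g (b ∷ w) {u}) ⊒ b ∷ proj₁ (·-mono g w {u})
    grow′ b w = ⊒-++ (proj₁ (grow g b (w ++ u)))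

  hist-long : ∀ g x n → n ≤ length (g · hist x n)
  hist-long g x n = subst (_≤ length (g · hist x n)) (hist-length x n) (·-length g (hist x n))

  module Branch (g : Tree) (x : Pt) = Limit.Along false (λ n → g · hist x n)
    (λ k → ⊒-trans (grow g (x k) (hist x k)) (⊒-++ (x k ∷ [])))
    (λ n → n , hist-long g x n)

  lim : Tree → Pt → Pt
  lim g x = Branch.limit g x

  hist-lim : ∀ g x n → hist (lim g x) (length (g · hist x n)) ≡ g · hist x n
  hist-lim g x n = Branch.hist-limit g x n

  lim-cofinal : ∀ g x n → g · hist x n ⊒ hist (lim g x) n
  lim-cofinal g x n = subst (_⊒ hist (lim g x) n) (hist-lim g x n)
    (hist-mono (lim g x) (hist-long g x n))

  -- The node `g · hist x n` has length at least `n`, so passing through all of these nodes leaves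
  -- no freedom. Agreement is expressed by `hist`, as pointwise equal functions need not be equal.
  lim-unique : ∀ g x {t : Pt} → (∀ n → ∃[ m ] hist t m ⊒ g · hist x n) →
               ∀ n → hist t n ≡ hist (lim g x) n
  lim-unique g x {t} through n = hist-restrict (hist-long g x n)
    (trans (hist-suffix (proj₁ (through n)) (proj₂ (through n))) (sym (hist-lim g x n)))

  lim-∙ : ∀ g h {k} → (∀ u → k · u ≡ g · h · u) → ∀ x n → hist (lim g (lim h x)) n ≡ hist (lim k x) n
  lim-∙ g h {k} eq x = lim-unique k x λ n → length (g · h · hist x n) , ⊒-reflexive
    (trans (trans (cong (λ u → hist (lim g (lim h x)) (length (g · u))) (sym (hist-lim h x n)))
           (hist-lim g (lim h x) (length (h · hist x n))))
    (trans (cong (g ·_) (hist-lim h x n)) (sym (eq (hist x n)))))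

  hist-shift : (x : Pt) (m k : ℕ) → hist (shift m x) k ++ hist x m ≡ hist x (k + m)
  hist-shift x m k = sym (hist-+ x k m)

  lim-cone : ∀ g x m n → hist (lim (g ∙ cone (hist x m)) (shift m x)) n ≡ hist (lim g x) n
  lim-cone g x m n = sym (lim-unique (g ∙ cone (hist x m)) (shift m x)
    (λ k → length (g · hist x (k + m)) , ⊒-reflexive
      (trans (hist-lim g x (k + m)) (cong (g ·_) (sym (hist-shift x m k))))) n)

  -- Enumerations of countable index sets

  Enumeration : Set → Set
  Enumeration I = Σ[ f ∈ (ℕ → I) ] (∀ i → ∃[ n ] f n ≡ i)

  -- Cantor's walk along the antidiagonals.
  diagonal : ℕ → ℕ × ℕ
  diagonal zero    = 0 , 0
  diagonal (suc n) with diagonal n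
  ... | a , zero  = 0 , suc a
  ... | a , suc b = suc a , b

  diagonal-surjective : ∀ a b → ∃[ n ] diagonal n ≡ (a , b)
  diagonal-surjective a b = go (a + b) a b refl
    where
    next : ∀ {a b} → ∃[ n ] diagonal n ≡ (a , suc b) → ∃[ n ] diagonal n ≡ (suc a , b)
    next (n , eq) = suc n , lemma eq
      where
      lemma : ∀ {a b} → diagonal n ≡ (a , suc b) → diagonal (suc n) ≡ (suc a , b)
      lemma eq rewrite eq = refl
    wrap : ∀ {a} → ∃[ n ] diagonal n ≡ (a , 0) → ∃[ n ] diagonal n ≡ (0 , suc a)
    wrap (n , eq) = suc n , lemma eq
      where
      lemma : ∀ {a} → diagonal n ≡ (a , 0) → diagonal (suc n) ≡ (0 , suc a)
      lemma eq rewrite eq = refl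
    go : ∀ s a b → a + b ≡ s → ∃[ n ] diagonal n ≡ (a , b)
    go zero    zero    zero    eq   = 0 , refl
    go (suc s) zero    (suc b) refl = wrap (go s s 0 (+-identityʳ s))
    go s       (suc a) b       eq   = next (go s a (suc b) (trans (+-suc a b) eq))

  ×-enumeration : {I J : Set} → Enumeration I → Enumeration J → Enumeration (I × J)
  ×-enumeration (f , f-onto) (g , g-onto) =
    (λ n → f (proj₁ (diagonal n)) , g (proj₂ (diagonal n))) , onto
    where
    onto : ∀ p → ∃[ n ] _ ≡ p
    onto (i , j) with f-onto i | g-onto j
    ... | a , refl | b , refl with diagonal-surjective a b
    ... | n , eq = n , cong (λ p → f (proj₁ p) , g (proj₂ p)) eq

  List-enumeration : Enumeration (List ℕ)
  List-enumeration = (λ n → decode (proj₁ (diagonal n)) (proj₂ (diagonal n))) , onto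
    where
    decode : ℕ → ℕ → List ℕ
    decode zero    c = []
    decode (suc k) c = proj₁ (diagonal c) ∷ decode k (proj₂ (diagonal c))
    encode : ∀ l → ∃[ c ] decode (length l) c ≡ l
    encode []      = 0 , refl
    encode (a ∷ l) with encode l
    ... | c , eq with diagonal-surjective a c
    ... | n , eq′ = n , cong₂ _∷_ (cong proj₁ eq′) (trans (cong (decode (length l) ∘ proj₂) eq′) eq)
    onto : ∀ l → ∃[ n ] _ ≡ l
    onto l with encode l
    ... | c , eq with diagonal-surjective (length l) c
    ... | n , eq′ = n , trans (cong (λ p → decode (proj₁ p) (proj₂ p)) eq′) eq

  -- Abstract block subspaces

  -- Block subspaces, seen through codes v : ℕ of vectors.  v ≫ n stands for
  -- n < min supp(v), and v ∈ zs ⊕ Z for membership in the span of zs and Z.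
  record BlockSpace : Set₁ where
    infix 4 _∈_ _∈_⊕_ _≫_ _⪯_ _⪯*_
    field
      𝕏      : Set
      _∈_    : ℕ → 𝕏 → Set
      _≫_    : ℕ → ℕ → Set
      _∈_⊕_  : ℕ → List ℕ → 𝕏 → Set

    _⪯_ : 𝕏 → 𝕏 → Set
    Y ⪯ X = ∀ {v} → v ∈ Y → v ∈ X

    -- Inclusion up to a finite part. A diagonal intersection lies below its spaces only in this
    -- sense, so whatever is to survive fusion must be inherited along `⪯*`.
    _⪯*_ : 𝕏 → 𝕏 → Set
    Y ⪯* X = ∃[ i ] (∀ {v} → v ∈ Y → v ≫ i → v ∈ X)

    field
      ≫-anti : ∀ {v m n} → m ≤ n → v ≫ n → v ≫ m
      tail   : 𝕏 → ℕ → 𝕏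
      tail-⪯ : ∀ X n → tail X n ⪯ X
      tail-≫ : ∀ X n {v} → v ∈ tail X n → v ≫ n
      []⊕    : ∀ {v Z} → v ∈ Z → v ∈ [] ⊕ Z
      ⊕-mono : ∀ {Y Z} → Y ⪯ Z → ∀ {zs v} → v ∈ zs ⊕ Y → v ∈ zs ⊕ Z
      []⊕⁻¹  : ∀ {v Z} → v ∈ [] ⊕ Z → v ∈ Z
      hd     : 𝕏 → ℕ
      tl     : 𝕏 → 𝕏
      tl-⪯   : ∀ Z → tl Z ⪯ Z
      ⊕-hd   : ∀ {Z zs v} → v ∈ hd Z ∷ zs ⊕ tl Z → v ∈ zs ⊕ Z
      bound  : 𝕏 → ℕ

    -- `bound Z` lies beyond the support of `hd Z`; the heads of a staircase therefore form a block
    -- sequence.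
    Staircase : (ℕ → 𝕏) → Set
    Staircase Z = ∀ n {v} → v ∈ Z (suc n) → v ≫ bound (Z n)

    field
      heads    : (Z : ℕ → 𝕏) → Staircase Z → 𝕏
      heads-⪯  : ∀ Z s {X} → (∀ n → Z n ⪯ X) → heads Z s ⪯ X
      heads-⪯* : ∀ Z s {X} m → (∀ n → m ≤ n → Z n ⪯ X) → heads Z s ⪯* X
      -- A vector in the span of the heads involves only finitely many of them, hence the arbitrary
      -- `W`.
      heads-⊕  : ∀ Z s {v} → v ∈ heads Z s →
                 ∃[ n ] (∀ m → n ≤ m → ∀ W → v ∈ hist (hd ∘ Z) m ⊕ W)

    ⪯⇒⪯* : ∀ {Y X} → Y ⪯ X → Y ⪯* X
    ⪯⇒⪯* p = 0 , λ y _ → p y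

    ⪯*-trans : ∀ {Z Y X} → Z ⪯* Y → Y ⪯* X → Z ⪯* X
    ⪯*-trans (i , p) (j , q) = i ⊔ j , λ z z≫ →
      q (p z (≫-anti (m≤m⊔n i j) z≫)) (≫-anti (m≤n⊔m i j) z≫)

    ⪯*-tail : ∀ {Y X} → Y ⪯* X → Σ[ Z ∈ 𝕏 ] (Z ⪯ Y × Z ⪯ X)
    ⪯*-tail {Y} (i , p) = tail Y i , tail-⪯ Y i , λ z → p (tail-⪯ Y i z) (tail-≫ Y i z)

    -- The `n`-th vector comes from `X n`, beyond the support of the preceding one; all but the
    -- first `m` vectors then lie in `X m`.
    diagonalise : (X : ℕ → 𝕏) → (∀ n → X (suc n) ⪯ X n) →
                  Σ[ Y ∈ 𝕏 ] (Y ⪯ X 0 × ∀ n → Y ⪯* X n)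
    diagonalise X decreasing = heads Z stair ,
      heads-⪯ Z stair (λ n → below {0} {n} z≤n) , λ m → heads-⪯* Z stair m λ n → below {m} {n}
      where
      Z : ℕ → 𝕏
      Z zero    = X 0
      Z (suc n) = tail (X (suc n)) (bound (Z n))
      stair : Staircase Z
      stair n = tail-≫ (X (suc n)) (bound (Z n))
      chain : ∀ j {n} → X (j + n) ⪯ X n
      chain zero    = id
      chain (suc j) = chain j ∘ decreasing (j + _)
      Z⪯ : ∀ n → Z n ⪯ X n
      Z⪯ zero    = id
      Z⪯ (suc n) = tail-⪯ (X (suc n)) (bound (Z n))
      below : ∀ {m n} → m ≤ n → Z n ⪯ X m
      below {m} {n} m≤n v∈ =
        chain (n ∸ m) (subst (λ k → _ ∈ X k) (sym (m∸n+n≡m m≤n)) (Z⪯ n v∈))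

  -- Fusion of conditions

  module Fusion (em : ExcludedMiddle 0ℓ) (S : BlockSpace) where
    open BlockSpace S

    Open : (Tree → 𝕏 → Set) → Set
    Open D = ∀ {g g′ X X′} → g′ ⊑ g → X′ ⪯* X → D g X → D g′ X′

    DenseBelow : 𝕏 → (Tree → 𝕏 → Set) → Set
    DenseBelow X₀ D = ∀ g X → X ⪯ X₀ →
      Σ[ g′ ∈ Tree ] Σ[ X′ ∈ 𝕏 ] (g′ ⊑ g × X′ ⪯ X × D g′ X′)

    module _ {X₀ : 𝕏} {D : Tree → 𝕏 → Set} (D-open : Open D) (D-dense : DenseBelow X₀ D) where

      Refinement : ℕ → (Word → Tree) → 𝕏 → Set
      Refinement n L X = Σ[ L′ ∈ (Word → Tree) ] Σ[ X′ ∈ 𝕏 ]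
        ((∀ u → L′ u ⊑ L u) × X′ ⪯ X × (∀ u → length u ≡ n → D (L′ u) X′))

      -- The nodes of level `n` are treated one after the other, each with its own tree but with one
      -- shrinking space. Openness preserves what was achieved at the earlier nodes.
      refine : ∀ n L X → X ⪯ X₀ → Refinement n L X
      refine zero L X X⪯ with D-dense (L []) X X⪯
      ... | g′ , X′ , g′⊑ , X′⪯ , d = L′ , X′ , L′⊑ , X′⪯ , λ { [] _ → d }
        where
        L′ : Word → Tree
        L′ []      = g′
        L′ (b ∷ u) = L (b ∷ u)
        L′⊑ : ∀ u → L′ u ⊑ L u
        L′⊑ []      = g′⊑
        L′⊑ (b ∷ u) = ⊑-refl
      refine (suc n) L X X⪯ with refine n (λ u → L (false ∷ u)) X X⪯
      ... | F , Y , F⊑ , Y⪯ , dF with refine n (λ u → L (true ∷ u)) Y (λ v → X⪯ (Y⪯ v))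
      ... | T , Z , T⊑ , Z⪯ , dT = L′ , Z , L′⊑ , (λ v → Y⪯ (Z⪯ v)) , d
        where
        L′ : Word → Tree
        L′ []          = L []
        L′ (false ∷ u) = F u
        L′ (true ∷ u)  = T u
        L′⊑ : ∀ u → L′ u ⊑ L u
        L′⊑ []          = ⊑-refl
        L′⊑ (false ∷ u) = F⊑ u
        L′⊑ (true ∷ u)  = T⊑ u
        d : ∀ u → length u ≡ suc n → D (L′ u) Z
        d (false ∷ u) eq = D-open ⊑-refl (⪯⇒⪯* Z⪯) (dF u (suc-injective eq))
        d (true ∷ u)  eq = dT u (suc-injective eq)

    module FusionLimit (L : Word → Tree) (L⊑ : ∀ b u → L (b ∷ u) ⊑ L u ∙ cone (b ∷ [])) where

      branch : ∀ {g h b} → (g⊑ : g ⊑ h ∙ cone (b ∷ [])) → g · [] ⊒ b ∷ h · []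
      branch {g} {h} {b} (via k e) = subst (_⊒ b ∷ h · []) (sym (e []))
        (⊒-trans (·-mono h (k · [])) (grow h b []))

      limitTree : Tree
      limitTree = tree (λ u → L u · []) λ b u → branch {h = L u} (L⊑ b u)

      module _ (u : Word) where
        path : Word → Tree
        path []      = idᵗ
        path (b ∷ w) = path w ∙ cone (b ∷ []) ∙ factor (L⊑ b (w ++ u))

        path-eq : ∀ w v → L (w ++ u) · v ≡ L u · path w · v
        path-eq []      v = refl
        path-eq (b ∷ w) v = trans (factors (L⊑ b (w ++ u)) v) (path-eq w _)

        -- Every node from `u` on is the root of a tree below `L u`; composing the factors met on
        -- the way (`path`) exhibits it as a node of `L u`.
        limitTree-⊑ : limitTree ∙ cone u ⊑ L u
        limitTree-⊑ = via (tree (λ w → path w · [])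
          (λ b w → branch {path (b ∷ w)} {path w} {b}
            (via (factor (L⊑ b (w ++ u))) λ _ → refl))) λ w → path-eq w []

    Fused : {I : Set} → (I → Tree → 𝕏 → Set) → Tree → 𝕏 → Set
    Fused D g X = ∀ i → ∃[ n ] (∀ u → n ≤ length u → D i (g ∙ cone u) X)

    module _ {I : Set} (enum : Enumeration I) {D : I → Tree → 𝕏 → Set}
             (D-open : ∀ i → Open (D i)) {X₀ : 𝕏} (D-dense : ∀ i → DenseBelow X₀ (D i)) where

      private
        Upto : ℕ → Tree → 𝕏 → Set
        Upto zero    g X = D (proj₁ enum 0) g X
        Upto (suc n) g X = Upto n g X × D (proj₁ enum (suc n)) g X

        Upto-open : ∀ n → Open (Upto n)
        Upto-open zero    p q d       = D-open _ p q d
        Upto-open (suc n) p q (d , e) = Upto-open n p q d , D-open _ p q e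

        Upto-dense : ∀ n → DenseBelow X₀ (Upto n)
        Upto-dense zero    g X X⪯ = D-dense _ g X X⪯
        Upto-dense (suc n) g X X⪯ with Upto-dense n g X X⪯
        ... | g′ , X′ , g′⊑ , X′⪯ , d with D-dense (proj₁ enum (suc n)) g′ X′ (λ v → X⪯ (X′⪯ v))
        ... | g″ , X″ , g″⊑ , X″⪯ , e =
          g″ , X″ , ⊑-trans g″⊑ g′⊑ , (λ v → X′⪯ (X″⪯ v)) , Upto-open n g″⊑ (⪯⇒⪯* X″⪯) d , e

        Upto-elim : ∀ {n i} → i ≤ n → ∀ {g X} → Upto n g X → D (proj₁ enum i) g X
        Upto-elim {zero}  z≤n d = d
        Upto-elim {suc n} i≤1+n (d , e) with m≤n⇒m<n∨m≡n i≤1+n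
        ... | inj₁ (s≤s i≤n) = Upto-elim i≤n d
        ... | inj₂ refl      = e

      private
        record Stage (n : ℕ) : Set where
          constructor stage
          field
            trees : Word → Tree
            space : 𝕏
            below : space ⪯ X₀
            upto  : ∀ u → length u ≡ n → Upto n (trees u) space

        open Stage

        Next : ∀ {n} → Stage n → Stage (suc n) → Set
        Next s s′ = (∀ b u → trees s′ (b ∷ u) ⊑ trees s u ∙ cone (b ∷ [])) × space s′ ⪯ space s

        start : ∀ g X → X ⪯ X₀ → Σ[ s ∈ Stage 0 ] (trees s [] ⊑ g × space s ⪯ X)
        start g X X⪯ with refine (Upto-open 0) (Upto-dense 0) 0 (λ _ → g) X X⪯
        ... | L , Y , L⊑ , Y⪯ , d = stage L Y (λ v → X⪯ (Y⪯ v)) d , L⊑ [] , Y⪯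

        next : ∀ n (s : Stage n) → Σ[ s′ ∈ Stage (suc n) ] Next s s′
        next n (stage L X X⪯ _)
          with refine (Upto-open (suc n)) (Upto-dense (suc n)) (suc n) split X X⪯
          where
          split : Word → Tree
          split []      = L []
          split (b ∷ u) = L u ∙ cone (b ∷ [])
        ... | L′ , Y , L′⊑ , Y⪯ , d =
          stage L′ Y (λ v → X⪯ (Y⪯ v)) d , (λ b u → L′⊑ (b ∷ u)) , Y⪯

        fuse : (s : ∀ n → Stage n) → (∀ n → Next (s n) (s (suc n))) →
               Σ[ g ∈ Tree ] Σ[ X ∈ 𝕏 ] (g ⊑ trees (s 0) [] × X ⪯ space (s 0) × Fused D g X)
        fuse s linked = limitTree , Y , whole , Y⪯ , fused
          where
          open FusionLimit (λ u → trees (s (length u)) u) (λ b u → proj₁ (linked (length u)) b u)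
          diag = diagonalise (λ n → space (s n)) (λ n → proj₂ (linked n))
          Y    = proj₁ diag
          Y⪯   = proj₁ (proj₂ diag)
          whole : limitTree ⊑ trees (s 0) []
          whole = ⊑-trans (via idᵗ λ u → cong (limitTree ·_) (sym (++-identityʳ u))) (limitTree-⊑ [])
          fused : Fused D limitTree Y
          fused i with proj₂ enum i
          ... | n , refl = n , λ u n≤u → Upto-elim n≤u
            (Upto-open (length u) (limitTree-⊑ u) (proj₂ (proj₂ diag) (length u))
                       (upto (s (length u)) u refl))

      abstract
        fusion : ∀ g X → X ⪯ X₀ → Σ[ g′ ∈ Tree ] Σ[ X′ ∈ 𝕏 ] (g′ ⊑ g × X′ ⪯ X × Fused D g′ X′)
        fusion g X X⪯ with start g X X⪯
        ... | s₀ , s₀⊑ , s₀⪯ = finish (fuse stages (λ n → proj₂ (next n (stages n))))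
          where
          stages : ∀ n → Stage n
          stages zero    = s₀
          stages (suc n) = proj₁ (next n (stages n))
          finish : Σ[ g′ ∈ Tree ] Σ[ X′ ∈ 𝕏 ] (g′ ⊑ trees s₀ [] × X′ ⪯ space s₀ × Fused D g′ X′) →
                   Σ[ g′ ∈ Tree ] Σ[ X′ ∈ 𝕏 ] (g′ ⊑ g × X′ ⪯ X × Fused D g′ X′)
          finish (g′ , X′ , g′⊑ , X′⪯ , fused) =
            g′ , X′ , ⊑-trans g′⊑ s₀⊑ , (λ v → s₀⪯ (X′⪯ v)) , fused

    Never : (Tree → 𝕏 → Set) → Tree → 𝕏 → Set
    Never W g X = ∀ g′ X′ → g′ ⊑ g → X′ ⪯* X → ¬ W g′ X′

    Never-open : ∀ W → Open (Never W)
    Never-open W p q never g′ X′ p′ q′ = never g′ X′ (⊑-trans p′ p) (⪯*-trans q′ q)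

    Decides : (Tree → 𝕏 → Set) → Tree → 𝕏 → Set
    Decides W g X = W g X ⊎ Never W g X

    -- The search runs over `⪯`, but `Never` speaks of `⪯*`. A tail of `X′` lies below both `X′` and
    -- `X`, and openness carries `W` to it.
    someBelow-or-never : ∀ {W} → Open W → ∀ g X →
      (Σ[ g′ ∈ Tree ] Σ[ X′ ∈ 𝕏 ] (g′ ⊑ g × X′ ⪯ X × W g′ X′)) ⊎ Never W g X
    someBelow-or-never {W} W-open g X with em {Σ[ g′ ∈ Tree ] Σ[ X′ ∈ 𝕏 ] (g′ ⊑ g × X′ ⪯ X × W g′ X′)}
    ... | yes some = inj₁ some
    ... | no none  = inj₂ λ g′ X′ g′⊑ X′⪯* w →
      let (Z , Z⪯X′ , Z⪯X) = ⪯*-tail X′⪯* in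
      none (g′ , Z , g′⊑ , Z⪯X , W-open ⊑-refl (⪯⇒⪯* Z⪯X′) w)

    decide : {I : Set} → Enumeration I → {W : I → Tree → 𝕏 → Set} → (∀ i → Open (W i)) →
             ∀ X → Σ[ g ∈ Tree ] Σ[ X′ ∈ 𝕏 ] (X′ ⪯ X × Fused (λ i → Decides (W i)) g X′)
    decide enum {W} W-open X with fusion enum {λ i → Decides (W i)} dec-open {X} dec-dense idᵗ X id
      where
      dec-open : ∀ i → Open (Decides (W i))
      dec-open i p q (inj₁ w) = inj₁ (W-open i p q w)
      dec-open i p q (inj₂ n) = inj₂ (Never-open (W i) p q n)
      dec-dense : ∀ i → DenseBelow X (Decides (W i))
      dec-dense i g Y _ with someBelow-or-never (W-open i) g Y
      ... | inj₁ (g′ , Y′ , p , q , w) = g′ , Y′ , p , q , inj₁ w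
      ... | inj₂ never                 = g , Y , ⊑-refl , id , inj₂ never
    ... | g , X′ , _ , X′⪯ , fused = g , X′ , X′⪯ , fused

  -- A pigeonhole principle uniform in the parameter

  module Uniformization (em : ExcludedMiddle 0ℓ) (S : BlockSpace) where
    open BlockSpace S
    open Fusion em S

    -- Such a `B` codes, for each `v`, an open set of parameters: the points having some node `u`
    -- with `B u v`.
    UpwardClosed : {V : Set} → (Word → V → Set) → Set
    UpwardClosed B = ∀ {u u′} → u′ ⊒ u → ∀ {v} → B u v → B u′ v

    module _ (B : Word → ℕ → Set) (B-up : UpwardClosed B) where

      -- `zs` are the vectors already committed to the subspace under construction; only the part
      -- `Z` can still be changed.
      Meets : List ℕ → Tree → 𝕏 → Set
      Meets zs g X = ∀ y Z → Z ⪯ X → ∃[ v ] (v ∈ zs ⊕ Z × ∃[ n ] B (g · hist y n) v)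

      Meets-open : ∀ zs → Open (Meets zs)
      Meets-open zs {g} (via h eq) X′⪯*X meets y Z Z⪯X′
        with ⪯*-tail (⪯*-trans (⪯⇒⪯* Z⪯X′) X′⪯*X)
      ... | Z′ , Z′⪯Z , Z′⪯X with meets (lim h y) Z′ Z′⪯X
      ... | v , v∈ , n , b = v , ⊕-mono Z′⪯Z v∈ , n ,
        subst (λ u → B u v) (sym (eq (hist y n))) (B-up (·-⊒ g (lim-cofinal h y n)) b)

      Misses : List ℕ → Tree → Pt → 𝕏 → Set
      Misses zs g y Z = ∀ v → v ∈ zs ⊕ Z → ∀ n → ¬ B (g · hist y n) v

      misses : ∀ {zs g X} → ¬ Meets zs g X → Σ[ Z ∈ 𝕏 ] Σ[ y ∈ Pt ] (Z ⪯ X × Misses zs g y Z)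
      misses {zs} {g} {X} ¬meets with em {Σ[ Z ∈ 𝕏 ] Σ[ y ∈ Pt ] (Z ⪯ X × Misses zs g y Z)}
      ... | yes found = found
      ... | no none   = ⊥-elim (¬meets meets)
        where
        meets : Meets zs g X
        meets y Z Z⪯X with em {∃[ v ] (v ∈ zs ⊕ Z × ∃[ n ] B (g · hist y n) v)}
        ... | yes found = found
        ... | no none′  = ⊥-elim (none (Z , y , Z⪯X , λ v v∈ n b → none′ (v , v∈ , n , b)))

      module Construction {X} (never : Never (Meets []) idᵗ X) (g : Tree) {X₁} (X₁⪯X : X₁ ⪯ X)
                          (decided : Fused (λ zs → Decides (Meets zs)) g X₁) where

        Alive : List ℕ → Word → Set
        Alive zs u = Never (Meets zs) (g ∙ cone u) X₁

        Alive-up : ∀ zs {u u′} → u′ ⊒ u → Alive zs u → Alive zs u′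
        Alive-up zs p = Never-open (Meets zs) (∙-⊑-∙ g (cone-⊑-cone p)) (⪯⇒⪯* id)

        alive⇒misses : ∀ {zs u} → Alive zs u → ∀ {X′} → X′ ⪯ X₁ →
                       Σ[ Z ∈ 𝕏 ] Σ[ y ∈ Pt ] (Z ⪯ X′ × Misses zs (g ∙ cone u) y Z)
        alive⇒misses {zs} {u} alive {X′} X′⪯ = misses {g = g ∙ cone u} (alive (g ∙ cone u) X′ ⊑-refl (⪯⇒⪯* X′⪯))

        -- Missing the bad vectors is inherited by smaller spaces. So the nodes can be handled
        -- successively, each with its own escaping point and all with the same final `Z`.
        simultaneously : ∀ n zs (node : Word → Word) → (∀ u → length u ≡ n → Alive zs (node u)) →
          ∀ X′ → X′ ⪯ X₁ → Σ[ Z ∈ 𝕏 ] Σ[ y ∈ (Word → Pt) ]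
            (Z ⪯ X′ × ∀ u → length u ≡ n → Misses zs (g ∙ cone (node u)) (y u) Z)
        simultaneously zero zs node alive X′ X′⪯ with alive⇒misses (alive [] refl) X′⪯
        ... | Z , y , Z⪯ , miss = Z , (λ _ → y) , Z⪯ , λ { [] _ → miss }
        simultaneously (suc n) zs node alive X′ X′⪯
          with simultaneously n zs (node ∘ (false ∷_)) (λ u e → alive (false ∷ u) (cong suc e)) X′ X′⪯
        ... | Z , y , Z⪯ , miss
          with simultaneously n zs (node ∘ (true ∷_)) (λ u e → alive (true ∷ u) (cong suc e))
                              Z (λ v → X′⪯ (Z⪯ v))
        ... | Z′ , y′ , Z′⪯ , miss′ = Z′ , y″ , (λ v → Z⪯ (Z′⪯ v)) , miss″
          where
          y″ : Word → Pt
          y″ []          = y []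
          y″ (false ∷ u) = y u
          y″ (true ∷ u)  = y′ u
          miss″ : ∀ u → length u ≡ suc n → Misses zs (g ∙ cone (node u)) (y″ u) Z′
          miss″ (false ∷ u) e v v∈ = miss u (suc-injective e) v (⊕-mono Z′⪯ v∈)
          miss″ (true ∷ u)  e      = miss′ u (suc-injective e)

        record Stage (n : ℕ) : Set where
          constructor stage
          field
            prefix : List ℕ
            node   : Word → Word
            last   : 𝕏
            last⪯  : last ⪯ X₁
            alive  : ∀ u → length u ≡ n → Alive prefix (node u)

        open Stage

        record Next {n} (s : Stage n) (s′ : Stage (suc n)) : Set where
          constructor next
          field
            splits  : ∀ b u → node s′ (b ∷ u) ⊒ b ∷ node s u
            prefix≡ : prefix s′ ≡ hd (last s′) ∷ prefix s
            beyond  : ∀ {v} → v ∈ last s′ → v ≫ bound (last s)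

        open Next

        start : Stage 0
        start = stage [] id X₁ id λ u _ → Never-open (Meets []) (via (g ∙ cone u) λ _ → refl) (⪯⇒⪯* X₁⪯X) never

        -- The first vector of the common space `Z` is committed, and each node is prolonged along
        -- its escaping point until `hd Z ∷ zs` is decided there. The decision cannot be `Meets`:
        -- tested on the rest of that point and on `tl Z`, it would yield a bad vector of `zs ⊕ Z`
        -- at a point where there is none.
        advance : ∀ n (s : Stage n) → Σ[ s′ ∈ Stage (suc n) ] Next s s′
        advance n (stage zs node last last⪯ alive)
          with simultaneously (suc n) zs split split-alive (tail X₁ (bound last)) (tail-⪯ X₁ (bound last))
          where
          split : Word → Word
          split []      = []
          split (b ∷ u) = b ∷ node u
          split-alive : ∀ u → length u ≡ suc n → Alive zs (split u)
          split-alive (b ∷ u) e = Alive-up zs (⊒-++ (b ∷ [])) (alive u (suc-injective e))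
        ... | Z , y , Z⪯ , miss = stage (hd Z ∷ zs) node′ Z (λ v → tail-⪯ X₁ _ (Z⪯ v)) alive′ ,
          next (λ b u → ⊒-++ (hist (y (b ∷ u)) level)) refl (λ v → tail-≫ X₁ _ (Z⪯ v))
          where
          level : ℕ
          level = proj₁ (decided (hd Z ∷ zs))
          node′ : Word → Word
          node′ []      = []
          node′ (b ∷ u) = hist (y (b ∷ u)) level ++ b ∷ node u
          long : ∀ b u → level ≤ length (node′ (b ∷ u))
          long b u = hist-++-length (y (b ∷ u)) level
          alive′ : ∀ u → length u ≡ suc n → Alive (hd Z ∷ zs) (node′ u)
          alive′ (b ∷ u) e with proj₂ (decided (hd Z ∷ zs)) (node′ (b ∷ u)) (long b u)
          ... | inj₂ alive″ = alive″
          ... | inj₁ meets with meets (shift level (y (b ∷ u))) (tl Z) (λ v → tail-⪯ X₁ _ (Z⪯ (tl-⪯ Z v)))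
          ... | v , v∈ , m , bad = ⊥-elim (miss (b ∷ u) e v (⊕-hd v∈) (m + level)
                (subst (λ w → B (g · w) v) word-eq bad))
            where
            word-eq : hist (shift level (y (b ∷ u))) m ++ node′ (b ∷ u) ≡ hist (y (b ∷ u)) (m + level) ++ b ∷ node u
            word-eq = trans (sym (++-assoc (hist (shift level (y (b ∷ u))) m) _ _))
              (cong (_++ b ∷ node u) (hist-shift (y (b ∷ u)) level m))

        Result : Set
        Result = Σ[ g′ ∈ Tree ] Σ[ X′ ∈ 𝕏 ] (X′ ⪯ X × ∀ v → v ∈ X′ → ∀ w → ¬ B (g′ · w) v)

        conclude : (s : ∀ n → Stage n) → prefix (s 0) ≡ [] → (∀ n → Next (s n) (s (suc n))) → Result
        conclude s s₀ linked = g ∙ H , Y ,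
          (λ v → X₁⪯X (heads-⪯ Z stair (λ n → last⪯ (s (suc n))) v)) , avoid
          where
          H : Tree
          H = tree (λ u → node (s (length u)) u) λ b u → splits (linked (length u)) b u
          Z : ℕ → 𝕏
          Z n = last (s (suc n))
          stair : Staircase Z
          stair n = beyond (linked (suc n))
          Y : 𝕏
          Y = heads Z stair
          prefixes : ∀ n → prefix (s n) ≡ hist (hd ∘ Z) n
          prefixes zero    = s₀
          prefixes (suc n) = trans (prefix≡ (linked n)) (cong (hd (Z n) ∷_) (prefixes n))
          -- B is open, so it suffices to refute it at one point below a long extension of w.
          avoid : ∀ v → v ∈ Y → ∀ w → ¬ B (g · H · w) v
          avoid v v∈Y w bad with heads-⊕ Z stair v∈Y
          ... | n , v∈ with alive⇒misses (alive (s (length w′)) w′ refl) id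
            where
            w′ : Word
            w′ = hist (λ _ → false) n ++ w
          ... | W , y , _ , miss = miss v
                (subst (λ zs → v ∈ zs ⊕ W) (sym (prefixes (length w′)))
                  (v∈ (length w′) (hist-++-length _ n) W))
                0 (B-up (·-⊒ g (·-mono H (hist _ n))) bad)
            where
            w′ : Word
            w′ = hist (λ _ → false) n ++ w

        result : Result
        result = conclude stages refl λ n → proj₂ (advance n (stages n))
          where
          stages : ∀ n → Stage n
          stages zero    = start
          stages (suc n) = proj₁ (advance n (stages n))

      abstract
        uniformize : ∀ X →
          (Σ[ g ∈ Tree ] Σ[ X′ ∈ 𝕏 ] (X′ ⪯ X ×
            ∀ y Z → Z ⪯ X′ → ∃[ v ] (v ∈ Z × ∃[ n ] B (g · hist y n) v)))
          ⊎ (Σ[ g ∈ Tree ] Σ[ X′ ∈ 𝕏 ] (X′ ⪯ X × ∀ v → v ∈ X′ → ∀ w → ¬ B (g · w) v))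
        uniformize X with someBelow-or-never (Meets-open []) idᵗ X
        ... | inj₁ (g , X′ , _ , X′⪯ , meets) = inj₁ (g , X′ , X′⪯ , λ y Z Z⪯ →
                let (v , v∈ , b) = meets y Z Z⪯ in v , []⊕⁻¹ v∈ , b)
        ... | inj₂ never with decide List-enumeration Meets-open X
        ... | g , X₁ , X₁⪯ , decided = inj₂ (Construction.result never g X₁⪯ decided)

  -- Open games

  module OpenGame (em : ExcludedMiddle 0ℓ) (S : BlockSpace) where
    open BlockSpace S
    open Fusion em S
    open Uniformization em S using (UpwardClosed; uniformize)

    -- II can force the play, continuing from the history r against subspaces
    -- of X, to reach Goal after at least one more move.
    data Reach (Goal : List ℕ → Set) (X : 𝕏) (r : List ℕ) : Set where
      step : (∀ Z → Z ⪯ X → Σ[ v ∈ ℕ ] (v ∈ Z × (Goal (v ∷ r) ⊎ Reach Goal X (v ∷ r)))) →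
             Reach Goal X r

    mutual
      reach-map : ∀ {P Q X X′} → (∀ r → P r → Q r) → X′ ⪯* X → ∀ {r} → Reach P X r → Reach Q X′ r
      reach-map f X′⪯*X (step answer) = step λ Z Z⪯X′ →
        let (Y , Y⪯Z , Y⪯X) = ⪯*-tail (⪯*-trans (⪯⇒⪯* Z⪯X′) X′⪯*X)
        in answer-map f X′⪯*X Y⪯Z (answer Y Y⪯X)

      answer-map : ∀ {P Q X X′} → (∀ r → P r → Q r) → X′ ⪯* X → ∀ {Y Z} → Y ⪯ Z → ∀ {r} →
                   Σ[ v ∈ ℕ ] (v ∈ Y × (P (v ∷ r) ⊎ Reach P X (v ∷ r))) →
                   Σ[ v ∈ ℕ ] (v ∈ Z × (Q (v ∷ r) ⊎ Reach Q X′ (v ∷ r)))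
      answer-map f q Y⪯Z (v , v∈ , inj₁ p) = v , Y⪯Z v∈ , inj₁ (f (v ∷ _) p)
      answer-map f q Y⪯Z (v , v∈ , inj₂ d) = v , Y⪯Z v∈ , inj₂ (reach-map f q d)

    -- Histories properly extending s in which I plays ν in the asymptotic game.
    data Run (X : 𝕏) (ν : List ℕ → ℕ) (s : List ℕ) : List ℕ → Set where
      first : ∀ {v} → v ∈ X → v ≫ ν s → Run X ν s (v ∷ s)
      next  : ∀ {r v} → Run X ν s r → v ∈ X → v ≫ ν r → Run X ν s (v ∷ r)

    module _ (G : Word → List ℕ → Set) (G-up : UpwardClosed G) where

      Win : List ℕ → Tree → 𝕏 → Set
      Win r g X = ∀ y → Reach (λ r′ → ∃[ n ] G (g · hist y n) r′) X r

      Win-open : ∀ r → Open (Win r)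
      Win-open r {g} (via h eq) X′⪯*X win y = reach-map
        (λ { r′ (n , good) → n , subst (λ u → G u r′) (sym (eq (hist y n)))
               (G-up (·-⊒ g (lim-cofinal h y n)) good) })
        X′⪯*X (win (lim h y))

      win-at : ∀ f h y n {X r} → Win r (f ∙ cone (h · hist y n)) X →
               Reach (λ r′ → ∃[ m ] G (f · h · hist y m) r′) X r
      win-at f h y n {X} {r} win = reach-map
        (λ { r′ (m , good) → m + n , subst (λ u → G (f · h · u) r′) (hist-shift y n m) good })
        (⪯⇒⪯* id)
        (Win-open r (∙-⊑-∙ f (∙-cone-⊑ h (hist y n))) (⪯⇒⪯* id) win (shift n y))

      module Escape {X s} (never : Never (Win s) idᵗ X) (g₁ : Tree) {X₁} (X₁⪯X : X₁ ⪯ X)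
                          (decided : Fused (λ r → Decides (Win r)) g₁ X₁) where

        -- The positions that I has to keep away from. Both alternatives persist at longer words,
        -- which is what `uniformize` asks for.
        Bad : Word → List ℕ → Set
        Bad u r = G (g₁ · u) r ⊎ Win r (g₁ ∙ cone u) X₁

        Bad-up : UpwardClosed Bad
        Bad-up p (inj₁ good)      = inj₁ (G-up (·-⊒ g₁ p) good)
        Bad-up p {r} (inj₂ win)   = inj₂ (Win-open r (∙-⊑-∙ g₁ (cone-⊑-cone p)) (⪯⇒⪯* id) win)

        AvoidsBeyond : ℕ → List ℕ → Tree → 𝕏 → Set
        AvoidsBeyond i r g Y = ∀ v → v ∈ Y → v ≫ i → ∀ w → ¬ Bad (g · w) (v ∷ r)

        D : List ℕ → Tree → 𝕏 → Set
        D r g Y = Win r (g₁ ∙ g) Y ⊎ ∃[ i ] AvoidsBeyond i r g Y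

        D-open : ∀ r → Open (D r)
        D-open r p q (inj₁ win) = inj₁ (Win-open r (∙-⊑-∙ g₁ p) q win)
        D-open r (via h eq) (j , q) (inj₂ (i , avoid)) = inj₂ (i ⊔ j , λ v v∈ v≫ w bad →
          avoid v (q v∈ (≫-anti (m≤n⊔m i j) v≫)) (≫-anti (m≤m⊔n i j) v≫) (h · w)
            (subst (λ u → Bad u (v ∷ r)) (eq w) bad))

        -- `uniformize` is applied to the moves `v` leading from `r` to a bad position. If every
        -- subspace contains one, playing it wins for II from `r`; otherwise all moves in some
        -- subspace stay out of the bad positions.
        D-dense : ∀ r → DenseBelow X₁ (D r)
        D-dense r g Y Y⪯
          with uniformize (λ w v → Bad (g · w) (v ∷ r)) (λ p → Bad-up (·-⊒ g p)) Y
        ... | inj₂ (g′ , Y′ , Y′⪯ , avoid) =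
          g ∙ g′ , Y′ , ∙-⊑ g g′ , Y′⪯ , inj₂ (0 , λ v v∈ _ → avoid v v∈)
        ... | inj₁ (g′ , Y′ , Y′⪯ , meets) = g ∙ g′ , Y′ , ∙-⊑ g g′ , Y′⪯ , inj₁ λ y → step λ Z Z⪯ →
          let (v , v∈ , n , bad) = meets y Z Z⪯ in v , v∈ , continue y n v bad
          where
          Goal : Pt → List ℕ → Set
          Goal y r′ = ∃[ m ] G (g₁ · g · g′ · hist y m) r′
          continue : ∀ y n v → Bad (g · g′ · hist y n) (v ∷ r) → Goal y (v ∷ r) ⊎ Reach (Goal y) Y′ (v ∷ r)
          continue y n v (inj₁ good) = inj₁ (n , good)
          continue y n v (inj₂ win)  = inj₂ (reach-map (λ _ → id) (⪯⇒⪯* λ u → Y⪯ (Y′⪯ u))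
            (win-at g₁ (g ∙ g′) y n win))

        Result : Set
        Result = Σ[ g ∈ Tree ] Σ[ X′ ∈ 𝕏 ] Σ[ ν ∈ (List ℕ → ℕ) ]
          (X′ ⪯ X × ∀ r → Run X′ ν s r → ∀ w → ¬ G (g · w) r)

        conclude : ∀ g₂ X₂ → X₂ ⪯ X₁ → Fused D g₂ X₂ → Result
        conclude g₂ X₂ X₂⪯ fused = g₁ ∙ g₂ , X₂ , ν , (λ v → X₁⪯X (X₂⪯ v)) ,
          λ r run w good → run⇒safe run w (inj₁ good)
          where
          level : List ℕ → ℕ
          level r = proj₁ (fused r)

          Settled : List ℕ → Word → ℕ → Set
          Settled r u i = Win r (g₁ ∙ g₂ ∙ cone u) X₂ ⊎ AvoidsBeyond i r (g₂ ∙ cone u) X₂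

          settle-mono : ∀ r {u i j} → i ≤ j → Settled r u i → Settled r u j
          settle-mono r i≤j (inj₁ win)   = inj₁ win
          settle-mono r i≤j (inj₂ avoid) = inj₂ λ v v∈ v≫ → avoid v v∈ (≫-anti i≤j v≫)

          -- The threshold of `AvoidsBeyond` may differ from node to node, whereas I has to name one
          -- number; the nodes of a single level suffice for the decision.
          settle : ∀ r → ∃[ i ] (∀ u → length u ≡ level r → Settled r u i)
          settle r = uniform-bound (level r) (settle-mono r) λ u e →
            case′ (proj₂ (fused r) u (≤-reflexive (sym e)))
            where
            case′ : ∀ {u} → D r (g₂ ∙ cone u) X₂ → ∃[ i ] Settled r u i
            case′ (inj₁ win)         = 0 , inj₁ win
            case′ (inj₂ (i , avoid)) = i , inj₂ avoid

          ν : List ℕ → ℕ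
          ν r = proj₁ (settle r)

          Safe Lost : List ℕ → Set
          Safe r = ∀ w → ¬ Bad (g₂ · w) r
          Lost r = ∀ u → ¬ Win r (g₁ ∙ g₂ ∙ cone u) X₂

          start-lost : Lost s
          start-lost u = never (g₁ ∙ g₂ ∙ cone u) X₂ (via (g₁ ∙ g₂ ∙ cone u) λ _ → refl)
                               (⪯⇒⪯* λ v → X₁⪯X (X₂⪯ v))

          -- `Safe` excludes a win against subspaces of `X₁`, `Lost` one against the fewer subspaces
          -- of `X₂`, which is a stronger claim. They are linked by `decided`: at a deep node, II
          -- wins against `X₁` or against nothing below it.
          safe⇒lost : ∀ {r} → Safe r → Lost r
          safe⇒lost {r} safe u win = refute (proj₂ (decided r) (g₂ · w)
              (≤-trans (hist-++-length _ n) (·-length g₂ w)))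
            where
            n : ℕ
            n = proj₁ (decided r)
            w : Word
            w = hist (λ _ → false) n ++ u
            refute : ¬ Decides (Win r) (g₁ ∙ cone (g₂ · w)) X₁
            refute (inj₁ win′)   = safe w (inj₂ win′)
            refute (inj₂ never′) = never′ (g₁ ∙ g₂ ∙ cone w) X₂
              (∙-⊑-∙ g₁ (∙-cone-⊑ g₂ w)) (⪯⇒⪯* X₂⪯)
              (Win-open r (∙-⊑-∙ g₁ (∙-⊑-∙ g₂ (cone-⊑-cone (⊒-++ (hist (λ _ → false) n))))) (⪯⇒⪯* id) win)

          lost⇒safe : ∀ {r v} → Lost r → v ∈ X₂ → v ≫ ν r → Safe (v ∷ r)
          lost⇒safe {r} {v} lost v∈ v≫ w bad
            -- Badness passes to longer words, so `w` may be padded with `false` until it runs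
            -- through a node of length `level r`.
            with splitAt-suffix (level r) (hist (λ _ → false) (level r) ++ w) (hist-++-length _ (level r))
          ... | u , len , x , eq = refute (proj₂ (settle r) u len)
            where
            refute : ¬ Settled r u (ν r)
            refute (inj₁ win)   = lost u win
            refute (inj₂ avoid) = avoid v v∈ v≫ x (subst (λ w′ → Bad (g₂ · w′) (v ∷ r)) eq
              (Bad-up (·-mono g₂ (hist (λ _ → false) (level r))) bad))

          run⇒safe : ∀ {r} → Run X₂ ν s r → Safe r
          run⇒safe (first v∈ v≫)    = lost⇒safe start-lost v∈ v≫
          run⇒safe (next run v∈ v≫) = lost⇒safe (safe⇒lost (run⇒safe run)) v∈ v≫

        result : Result
        result with fusion List-enumeration D-open D-dense idᵗ X₁ id
        ... | g₂ , X₂ , _ , X₂⪯ , fused = conclude g₂ X₂ X₂⪯ fused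

      abstract
        openDichotomy : ∀ s X →
          (Σ[ g ∈ Tree ] Σ[ X′ ∈ 𝕏 ] (X′ ⪯ X × Win s g X′))
          ⊎ (Σ[ g ∈ Tree ] Σ[ X′ ∈ 𝕏 ] Σ[ ν ∈ (List ℕ → ℕ) ]
               (X′ ⪯ X × ∀ r → Run X′ ν s r → ∀ w → ¬ G (g · w) r))
        openDichotomy s X with someBelow-or-never (Win-open s) idᵗ X
        ... | inj₁ (g , X′ , _ , X′⪯ , win) = inj₁ (g , X′ , X′⪯ , win)
        ... | inj₂ never with decide List-enumeration Win-open X
        ... | g₁ , X₁ , X₁⪯ , decided = inj₂ (Escape.result never g₁ X₁⪯ decided)

  -- Games with an analytic target

  maxUpto : ℕ → (ℕ → ℕ) → ℕ
  maxUpto zero    f = f 0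
  maxUpto (suc n) f = f (suc n) ⊔ maxUpto n f

  ≤-maxUpto : ∀ {a n} f → a ≤ n → f a ≤ maxUpto n f
  ≤-maxUpto {n = zero}  f z≤n = ≤-refl
  ≤-maxUpto {n = suc n} f a≤1+n with m≤n⇒m<n∨m≡n a≤1+n
  ... | inj₁ (s≤s a≤n) = ≤-trans (≤-maxUpto f a≤n) (m≤n⊔m (f (suc n)) _)
  ... | inj₂ refl      = m≤m⊔n (f (suc n)) _

  maxSuffix : List ℕ → (List ℕ → ℕ) → ℕ
  maxSuffix []      f = f []
  maxSuffix (v ∷ r) f = f (v ∷ r) ⊔ maxSuffix r f

  ≤-maxSuffix : ∀ {h r} f → h ⊒ r → f r ≤ maxSuffix h f
  ≤-maxSuffix {[]}    f ([] , refl)    = ≤-refl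
  ≤-maxSuffix {v ∷ h} f ([] , refl)    = m≤m⊔n (f (v ∷ h)) _
  ≤-maxSuffix {v ∷ h} f (a ∷ w , refl) = ≤-trans (≤-maxSuffix f (w , refl)) (m≤n⊔m (f (v ∷ h)) _)

  module AnalyticGame
    (em : ExcludedMiddle 0ℓ) (S : BlockSpace)
    -- The first argument is a witness that the other two lie in the analytic set. With the witness
    -- included the relation is closed; its projection is the analytic set.
    (Hit : (ℕ → ℕ) → Pt → (ℕ → ℕ) → Set)
    (Hit-closed : ∀ β t Y →
      (∀ n → Σ[ β′ ∈ (ℕ → ℕ) ] Σ[ t′ ∈ Pt ] Σ[ Y′ ∈ (ℕ → ℕ) ]
        (hist β′ n ≡ hist β n × hist t′ n ≡ hist t n × hist Y′ n ≡ hist Y n × Hit β′ t′ Y′)) →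
      Hit β t Y)
    where
    open BlockSpace S
    open Fusion em S
    open Uniformization em S using (UpwardClosed)
    open OpenGame em S

    Hit-cong : ∀ {β t t′ Y} → (∀ n → hist t n ≡ hist t′ n) → Hit β t Y → Hit β t′ Y
    Hit-cong {β} {t} {t′} {Y} eq hit =
      Hit-closed β t′ Y λ n → β , t , Y , refl , eq n , refl , hit

    Position : Set
    Position = List ℕ × List ℕ

    Through : Position → (ℕ → ℕ) → (ℕ → ℕ) → Set
    Through (s , α) Y β = hist Y (length s) ≡ s × hist β (length α) ≡ α

    -- `Y` is the whole outcome, history included, so the rules bind only from `length s` on. One
    -- `ν` serves every branch `y`.
    Avoids : Position → (List ℕ → ℕ) → Tree → 𝕏 → Set
    Avoids p ν g X = ∀ y Y β → Through p Y β →
      (∀ k → length (proj₁ p) ≤ k → Y k ∈ X × Y k ≫ ν (hist Y k)) → ¬ Hit β (lim g y) Y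

    Avoidable : Position → Tree → 𝕏 → Set
    Avoidable p g X = Σ[ ν ∈ (List ℕ → ℕ) ] Avoids p ν g X

    Avoidable-open : ∀ p → Open (Avoidable p)
    Avoidable-open p {g} {g′} (via h eq) (i , q) (ν , avoid) = (λ r → ν r ⊔ i) ,
      λ y Y β through moves hit → avoid (lim h y) Y β through
        (λ k s≤k → let (Yk∈ , Yk≫) = moves k s≤k in
          q Yk∈ (≫-anti (m≤n⊔m _ i) Yk≫) , ≫-anti (m≤m⊔n _ i) Yk≫)
        (Hit-cong (λ n → sym (lim-∙ g h {g′} eq y n)) hit)

    -- A larger number only restricts II further, so at each history the maximum of the finitely
    -- many strategies follows all of them.
    Avoidable-merge : ∀ p g {X} n → (∀ u → length u ≡ n → Avoidable p (g ∙ cone u) X) → Avoidable p g X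
    Avoidable-merge p g {X} n avoidable = (λ r → proj₁ (bound′ r)) ,
      λ y Y β through moves hit →
        let u = hist y n
            e = hist-length y n
        in proj₂ (avoidable u e) (shift n y) Y β through
          (λ k s≤k → let (Yk∈ , Yk≫) = moves k s≤k in
            Yk∈ , ≫-anti (proj₂ (bound′ (hist Y k)) u e e) Yk≫)
          (Hit-cong (λ m → sym (lim-cone g y n m)) hit)
      where
      -- The strategy at `u` is given through a proof that `u` has length `n`, hence the
      -- quantification over such proofs; they are all equal.
      bound′ : ∀ r → ∃[ i ] (∀ u → length u ≡ n → (e : length u ≡ n) → proj₁ (avoidable u e) r ≤ i)
      bound′ r = uniform-bound n (λ i≤j f e → ≤-trans (f e) i≤j) λ u e →
        proj₁ (avoidable u e) r ,
        λ e′ → ≤-reflexive (cong (λ e″ → proj₁ (avoidable u e″) r) (≡-irrelevant e′ e))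

    -- Live positions are those not avoidable near t.
    record Forcing (X : 𝕏) (t : Pt) : Set₁ where
      field
        Live   : List ℕ → List ℕ → Set
        start  : Live [] []
        extend : ∀ {s α} → Live s α → Reach (λ r → ∃[ a ] Live r (a ∷ α)) X s
        wins   : ∀ Y β → (∀ n → ∃[ k ] ∃[ j ] (n ≤ k × n ≤ j × Live (hist Y k) (hist β j))) →
                 Hit β t Y

    module Decided {X} (never : Never (Avoidable ([] , [])) idᵗ X) (ψ : Tree) {X₁} (X₁⪯X : X₁ ⪯ X)
                   (decided : Fused (λ p → Decides (Avoidable p)) ψ X₁) where

      Good : Word → Position → Set
      Good u p = Never (Avoidable p) (ψ ∙ cone u) X₁

      Good-up : ∀ p {u u′} → u′ ⊒ u → Good u p → Good u′ p
      Good-up p q = Never-open (Avoidable p) (∙-⊑-∙ ψ (cone-⊑-cone q)) (⪯⇒⪯* id)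

      NextDigit : List ℕ → Word → List ℕ → Set
      NextDigit α u r = ∃[ a ] Good u (r , a ∷ α)

      NextDigit-up : ∀ α → UpwardClosed (NextDigit α)
      NextDigit-up α p {r} (a , good) = a , Good-up (r , a ∷ α) p good

      D : Position → Tree → 𝕏 → Set
      D (s , α) g Y = Avoidable (s , α) (ψ ∙ g) Y ⊎ Win (NextDigit α) (NextDigit-up α) s g Y

      D-open : ∀ p → Open (D p)
      D-open p {g} {g′} q q′ (inj₁ avoidable) = inj₁ (Avoidable-open p {ψ ∙ g} {ψ ∙ g′} (∙-⊑-∙ ψ q) q′ avoidable)
      D-open (s , α) q q′ (inj₂ win) = inj₂ (Win-open (NextDigit α) (NextDigit-up α) s q q′ win)

      -- I follows ν₀ and, from each history r passed on the way and for each
      -- digit a, eventually also the strategy avoiding (r , a ∷ α).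
      module Combine (s α : List ℕ) (g : Tree) {Y : 𝕏} (Y⪯X₁ : Y ⪯ X₁) (ν₀ : List ℕ → ℕ)
                     (avoid : ∀ r → Run Y ν₀ s r → ∀ w → ¬ NextDigit α (g · w) r) where

        run-avoidable : ∀ r → Run Y ν₀ s r → ∀ a → Avoidable (r , a ∷ α) (ψ ∙ g) Y
        run-avoidable r run a = Avoidable-merge (r , a ∷ α) (ψ ∙ g) (proj₁ (decided (r , a ∷ α))) λ u e →
          settle u (proj₂ (decided (r , a ∷ α)) (g · u)
                     (≤-trans (≤-reflexive (sym e)) (·-length g u)))
          where
          settle : ∀ u → Decides (Avoidable (r , a ∷ α)) (ψ ∙ cone (g · u)) X₁ →
                   Avoidable (r , a ∷ α) ((ψ ∙ g) ∙ cone u) Y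
          settle u (inj₁ avoidable) = Avoidable-open (r , a ∷ α) {ψ ∙ cone (g · u)} {(ψ ∙ g) ∙ cone u}
            (⊑-trans (via idᵗ λ _ → refl) (∙-⊑-∙ ψ (∙-cone-⊑ g u))) (⪯⇒⪯* Y⪯X₁) avoidable
          settle u (inj₂ good)      = ⊥-elim (avoid r run u (a , good))

        μ : List ℕ → ℕ → List ℕ → ℕ
        μ r a with em {Run Y ν₀ s r}
        ... | yes run = proj₁ (run-avoidable r run a)
        -- Histories that do not arise as runs against `ν₀` impose no constraint.
        ... | no _    = λ _ → 0

        μ-avoids : ∀ r → Run Y ν₀ s r → ∀ a → Avoids (r , a ∷ α) (μ r a) (ψ ∙ g) Y
        μ-avoids r run a with em {Run Y ν₀ s r}
        ... | yes run′ = proj₂ (run-avoidable r run′ a)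
        ... | no ¬run  = ⊥-elim (¬run run)

        ν : List ℕ → ℕ
        -- Finitely many strategies are obeyed at each move: those for suffixes `r` of `h` and
        -- digits up to `length h`.
        ν h = ν₀ h ⊔ maxSuffix h (λ r → maxUpto (length h) λ a → μ r a h)

        μ≤ν : ∀ {h r a} → h ⊒ r → a ≤ length h → μ r a h ≤ ν h
        μ≤ν {h} {r} {a} h⊒r a≤h = ≤-trans
          (≤-trans (≤-maxUpto (λ a′ → μ r a′ h) a≤h) (≤-maxSuffix _ h⊒r)) (m≤n⊔m (ν₀ h) _)

        avoidable : Avoidable (s , α) (ψ ∙ g) Y
        avoidable = ν , λ y W β (s-eq , α-eq) moves →
          let a  = β (length α)
              -- `a` is the next digit of the actual witness. After `k₀` moves the history properly
              -- extends `s` and is longer than `a`, so from there on `ν` dominates the strategy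
              -- avoiding `(hist W k₀ , a ∷ α)`.
              k₀ = suc (a + length s)
          in μ-avoids (hist W k₀) (runs W moves s-eq a) a y W β
               (cong (hist W) (hist-length W k₀) , cong (a ∷_) α-eq)
               (λ k r≤k →
                 let k₀≤k = subst (_≤ k) (hist-length W k₀) r≤k
                     (Wk∈ , Wk≫) = moves k (≤-trans (m≤n+m _ (suc a)) k₀≤k)
                 in Wk∈ , ≫-anti (μ≤ν (hist-mono W k₀≤k) (≤-trans (≤-trans (≤-trans (n≤1+n a) (m≤m+n (suc a) _)) k₀≤k)
                                   (≤-reflexive (sym (hist-length W k))))) Wk≫)
          where
          runs : ∀ W → (∀ k → length s ≤ k → W k ∈ Y × W k ≫ ν (hist W k)) →
                  hist W (length s) ≡ s → ∀ j → Run Y ν₀ s (hist W (suc (j + length s)))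
          runs W moves s-eq zero    = subst (λ r → Run Y ν₀ s (W (length s) ∷ r)) (sym s-eq)
            (first (proj₁ (moves _ ≤-refl)) (subst (λ r → W (length s) ≫ ν₀ r) s-eq
              (≫-anti (m≤m⊔n (ν₀ (hist W (length s))) _) (proj₂ (moves _ ≤-refl)))))
          runs W moves s-eq (suc j) = next (runs W moves s-eq j) (proj₁ (moves _ k≤))
              (≫-anti (m≤m⊔n (ν₀ (hist W (suc (j + length s)))) _) (proj₂ (moves _ k≤)))
            where
            k≤ : length s ≤ suc (j + length s)
            k≤ = m≤n+m (length s) (suc j)

      D-dense : ∀ p → DenseBelow X₁ (D p)
      D-dense (s , α) g Y Y⪯
        with openDichotomy (λ w r → NextDigit α (g · w) r) (λ q → NextDigit-up α (·-⊒ g q)) s Y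
      ... | inj₁ (g′ , Y′ , Y′⪯ , win) = g ∙ g′ , Y′ , ∙-⊑ g g′ , Y′⪯ , inj₂ win
      ... | inj₂ (g′ , Y′ , ν₀ , Y′⪯ , avoid) = g ∙ g′ , Y′ , ∙-⊑ g g′ , Y′⪯ ,
        inj₁ (Combine.avoidable s α (g ∙ g′) (λ v → Y⪯ (Y′⪯ v)) ν₀ avoid)

      -- The failure of the constant strategy `0` already supplies an outcome through `p` together
      -- with a witness for it.
      hits : ∀ {p g Y} → ¬ Avoidable p g Y →
             Σ[ y ∈ Pt ] Σ[ W ∈ (ℕ → ℕ) ] Σ[ β ∈ (ℕ → ℕ) ] (Through p W β × Hit β (lim g y) W)
      hits {p} {g} ¬avoidable
        with em {Σ[ y ∈ Pt ] Σ[ W ∈ (ℕ → ℕ) ] Σ[ β ∈ (ℕ → ℕ) ] (Through p W β × Hit β (lim g y) W)}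
      ... | yes found = found
      ... | no none   = ⊥-elim (¬avoidable ((λ _ → 0) , λ y W β through _ hit →
                          none (y , W , β , through , hit)))

      module _ (g : Tree) (X₂ : 𝕏) (X₂⪯ : X₂ ⪯ X₁) (fused : Fused D g X₂) (y : Pt) where

        forcing : Forcing X₂ (lim (ψ ∙ g) y)
        forcing = record { Live = Live ; start = 0 , start ; extend = extend _ _ ; wins = wins }
          where
          Live : List ℕ → List ℕ → Set
          Live s α = ∃[ n ] Good (g · hist y n) (s , α)

          start : Good (g · []) ([] , [])
          start = Never-open (Avoidable ([] , [])) (via (ψ ∙ cone (g · [])) λ _ → refl) (⪯⇒⪯* X₁⪯X) never

          extend : ∀ s α → Live s α → Reach (λ r → ∃[ a ] Live r (a ∷ α)) X₂ s
          extend s α (n , good) = settle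
              (proj₂ (fused (s , α)) (hist y m) (≤-trans (m≤n⊔m n _) (≤-reflexive (sym (hist-length y m)))))
            where
            m : ℕ
            -- Deep enough for the position to be good and for `D (s , α)` to hold there.
            m = n ⊔ proj₁ (fused (s , α))
            settle : D (s , α) (g ∙ cone (hist y m)) X₂ → Reach (λ r → ∃[ a ] Live r (a ∷ α)) X₂ s
            settle (inj₁ avoidable) = ⊥-elim (good _ X₂
              (∙-⊑-∙ ψ (⊑-trans (∙-cone-⊑ g (hist y m)) (cone-⊑-cone (·-⊒ g (hist-mono y (m≤m⊔n n _))))))
              (⪯⇒⪯* X₂⪯) avoidable)
            settle (inj₂ win) = reach-map
              (λ { r (k , a , good′) → a , k + m ,
                   subst (λ u → Good (g · u) (r , a ∷ α)) (hist-shift y m k) good′ })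
              (⪯⇒⪯* id) (win (shift m y))

          -- A live position has a triple in `Hit` passing through it. Longer and longer live
          -- positions on `W` and `β`, at deeper and deeper nodes of the branch, give triples
          -- converging to the desired one, and `Hit` is closed.
          wins : ∀ W β → (∀ n → ∃[ k ] ∃[ j ] (n ≤ k × n ≤ j × Live (hist W k) (hist β j))) →
                 Hit β (lim (ψ ∙ g) y) W
          wins W β live = Hit-closed β (lim (ψ ∙ g) y) W approx
            where
            approx : ∀ n → _
            approx n with live n
            ... | k , j , n≤k , n≤j , m , good
              with hits {g = ψ ∙ cone (g · hist y (n ⊔ m))} (Good-up (hist W k , hist β j) (·-⊒ g (hist-mono y (m≤n⊔m n m))) good _ X₁ ⊑-refl (⪯⇒⪯* id))
            ... | y′ , W′ , β′ , (W-eq , β-eq) , hit =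
              β′ , lim (ψ ∙ cone u) y′ , W′ ,
              hist-restrict n≤j (trans (cong (hist β′) (sym (hist-length β j))) β-eq) ,
              hist-restrict (≤-trans (m≤m⊔n n m) (hist-long (ψ ∙ g) y (n ⊔ m)))
                (trans (hist-lim (ψ ∙ cone u) y′ 0) (sym (hist-lim (ψ ∙ g) y (n ⊔ m)))) ,
              hist-restrict n≤k (trans (cong (hist W′) (sym (hist-length W k))) W-eq) ,
              hit
              where
              u : Word
              u = g · hist y (n ⊔ m)

    abstract
      analyticDichotomy : ∀ X →
        (Σ[ g ∈ Tree ] Σ[ X′ ∈ 𝕏 ] (X′ ⪯ X × Avoidable ([] , []) g X′))
        ⊎ (Σ[ g ∈ Tree ] Σ[ X′ ∈ 𝕏 ] (X′ ⪯ X × ∀ y → Forcing X′ (lim g y)))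
      analyticDichotomy X with someBelow-or-never (Avoidable-open ([] , [])) idᵗ X
      ... | inj₁ (g , X′ , _ , X′⪯ , avoidable) = inj₁ (g , X′ , X′⪯ , avoidable)
      ... | inj₂ never with decide (×-enumeration List-enumeration List-enumeration) Avoidable-open X
      ... | ψ , X₁ , X₁⪯ , decided
        with fusion (×-enumeration List-enumeration List-enumeration)
               (Decided.D-open never ψ X₁⪯ decided) (Decided.D-dense never ψ X₁⪯ decided) idᵗ X₁ id
      ... | g , X₂ , _ , X₂⪯ , fused = inj₂ (ψ ∙ g , X₂ , (λ v → X₁⪯ (X₂⪯ v)) ,
              Decided.forcing never ψ X₁⪯ decided g X₂ X₂⪯ fused)

  -- Strategies for II in the Gowers game

  module Least (em : ExcludedMiddle 0ℓ) where

    IsLeast : (ℕ → Set) → ℕ → Set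
    IsLeast P v = P v × ∀ w → w < v → ¬ P w

    least : ∀ {P : ℕ → Set} → ∃[ v ] P v → ∃[ v ] IsLeast P v
    least {P} (v , p) = search v v ≤-refl p
      where
      search : ∀ n v → v ≤ n → P v → ∃[ v ] IsLeast P v
      search zero    v v≤0 p = v , p , λ w w<v → ⊥-elim (n≮0 (<-≤-trans w<v v≤0))
      search (suc n) v v≤  p with em {∃[ w ] (w < v × P w)}
      ... | yes (w , w<v , q) = search n w (≤-pred (<-≤-trans w<v v≤)) q
      ... | no none           = v , p , λ w w<v q → none (w , w<v , q)

    least-unique : ∀ {P Q : ℕ → Set} → (∀ v → P v → Q v) → (∀ v → Q v → P v) →
                   ∀ {v w} → IsLeast P v → IsLeast Q w → v ≡ w
    least-unique P⇒Q Q⇒P {v} {w} (p , v-least) (q , w-least) = ≤-antisym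
      (≮⇒≥ λ w<v → v-least w w<v (Q⇒P w q)) (≮⇒≥ λ v<w → w-least v v<w (P⇒Q v p))

  module GowersStrategy
    (em : ExcludedMiddle 0ℓ) (S : BlockSpace) {X : BlockSpace.𝕏 S}
    (Live : List ℕ → List ℕ → Set) (live₀ : Live [] [])
    (extend : ∀ {s α} → Live s α → OpenGame.Reach em S (λ r → ∃[ a ] Live r (a ∷ α)) X s)
    where
    open BlockSpace S
    open OpenGame em S
    open Least em

    NextLive : List ℕ → List ℕ → Set
    NextLive α r = ∃[ a ] Live r (a ∷ α)

    record State : Set where
      constructor state
      field
        past   : List ℕ
        digits : List ℕ
        plan   : Reach (NextLive digits) X past

    open State

    initial : State
    initial = state [] [] (extend live₀)

    -- The answers of a plan depend on the subspace played and not only on its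
    -- vectors.  To get a strategy compatible with equality of subspaces, II plays
    -- the least vector which is the planned answer to some subspace.
    Planned : State → ℕ → Set
    Planned (state s α (step answer)) v = Σ[ Z ∈ 𝕏 ] Σ[ p ∈ Z ⪯ X ] proj₁ (answer Z p) ≡ v

    choose : State → 𝕏 → Maybe ℕ
    choose q Z with em {∃[ v ] (v ∈ Z × Planned q v)}
    ... | yes found = just (proj₁ (least found))
    -- This occurs only if `Z` is not below `X`, that is, after an illegal move of I.
    ... | no _      = nothing

    choose-cong : ∀ q {Z Z′} → Z ⪯ Z′ → Z′ ⪯ Z → choose q Z ≡ choose q Z′
    choose-cong q {Z} {Z′} p p′
      with em {∃[ v ] (v ∈ Z × Planned q v)} | em {∃[ v ] (v ∈ Z′ × Planned q v)}
    ... | yes found         | yes found′        = cong just (least-unique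
      (λ { v (v∈ , a) → p v∈ , a }) (λ { v (v∈ , a) → p′ v∈ , a })
      (proj₂ (least found)) (proj₂ (least found′)))
    ... | yes (v , v∈ , a)  | no none           = ⊥-elim (none (v , p v∈ , a))
    ... | no none           | yes (v , v∈ , a)  = ⊥-elim (none (v , p′ v∈ , a))
    ... | no _              | no _              = refl

    Answer : State → Set
    Answer (state s α _) = ∃[ v ] (NextLive α (v ∷ s) ⊎ Reach (NextLive α) X (v ∷ s))

    perform : ∀ q → Answer q → ℕ × State
    perform (state s α _) (v , inj₁ (a , live)) = v , state (v ∷ s) (a ∷ α) (extend live)
    perform (state s α _) (v , inj₂ d)          = v , state (v ∷ s) α d

    -- The next state is computed from the code `v` alone: the subspace whose planned answer is
    -- followed is chosen from `v`, not taken from the move. Equal codes thus lead to equal states.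
    respondTo : ∀ q → Maybe ℕ → ℕ × State
    respondTo q nothing = 0 , q
    respondTo q@(state s α (step answer)) (just v) with em {Planned q v}
    ... | no _            = 0 , q
    ... | yes (Z , p , _) = perform q (proj₁ (answer Z p) , proj₂ (proj₂ (answer Z p)))

    respond : State → 𝕏 → ℕ × State
    respond q Z = respondTo q (choose q Z)

    respond-cong : ∀ q {Z Z′} → Z ⪯ Z′ → Z′ ⪯ Z → respond q Z ≡ respond q Z′
    respond-cong q p p′ = cong (respondTo q) (choose-cong q p p′)

    -- The answer may have been planned for a different subspace `Y`; it is acceptable against `Z`
    -- because its vector lies in `Z`.
    Legal : State → 𝕏 → ℕ × State → Set
    Legal q@(state s α (step answer)) Z (v , q′) = v ∈ Z × Σ[ Y ∈ 𝕏 ] Σ[ p ∈ Y ⪯ X ]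
      (v , q′) ≡ perform q (proj₁ (answer Y p) , proj₂ (proj₂ (answer Y p)))

    perform-fst : ∀ q x → proj₁ (perform q x) ≡ proj₁ x
    perform-fst (state s α _) (v , inj₁ (a , live)) = refl
    perform-fst (state s α _) (v , inj₂ d)          = refl

    respond-legal : ∀ q Z → Z ⪯ X → Legal q Z (respond q Z)
    respond-legal q@(state s α (step answer)) Z Z⪯X with em {∃[ v ] (v ∈ Z × Planned q v)}
    ... | no none   = ⊥-elim (none (proj₁ (answer Z Z⪯X) , proj₁ (proj₂ (answer Z Z⪯X)) , Z , Z⪯X , refl))
    ... | yes found with proj₁ (proj₂ (least found))
    ... | v∈Z , planned with em {Planned q (proj₁ (least found))}
    ... | no none          = ⊥-elim (none planned)
    ... | yes (Y , p , eq) = subst (_∈ Z) (sym (trans (perform-fst q (proj₁ (answer Y p) , proj₂ (proj₂ (answer Y p)))) eq)) v∈Z , Y , p , refl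

    run : State → (ℕ → 𝕏) → ℕ → State
    run q Z zero    = q
    run q Z (suc k) = proj₂ (respond (run q Z k) (Z k))

    module Play (Z : ℕ → 𝕏) (Z⪯X : ∀ k → Z k ⪯ X) where

      at : ℕ → State
      at = run initial Z

      out : ℕ → ℕ
      out k = proj₁ (respond (at k) (Z k))

      legal : ∀ k → Legal (at k) (Z k) (out k , at (suc k))
      legal k = respond-legal (at k) (Z k) (Z⪯X k)

      legal-∈ : ∀ {q Z v q′} → Legal q Z (v , q′) → v ∈ Z
      legal-∈ {state s α (step answer)} l = proj₁ l

      perform-past : ∀ q x {v q′} → (v , q′) ≡ perform q x → past q′ ≡ v ∷ past q
      perform-past (state s α _) (v , inj₁ (a , live)) refl = refl
      perform-past (state s α _) (v , inj₂ d)          refl = refl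

      perform-digits : ∀ q x {v q′} → (v , q′) ≡ perform q x → digits q′ ⊒ digits q
      perform-digits (state s α _) (v , inj₁ (a , live)) refl = ⊒-++ (a ∷ [])
      perform-digits (state s α _) (v , inj₂ d)          refl = ⊒-refl

      legal-past : ∀ {q Z v q′} → Legal q Z (v , q′) → past q′ ≡ v ∷ past q
      legal-past {q@(state s α (step answer))} (_ , Y , p , eq) = perform-past q _ eq

      legal-digits : ∀ {q Z v q′} → Legal q Z (v , q′) → digits q′ ⊒ digits q
      legal-digits {q@(state s α (step answer))} (_ , Y , p , eq) = perform-digits q _ eq

      past-hist : ∀ k → past (at k) ≡ hist out k
      past-hist zero    = refl
      past-hist (suc k) = trans (legal-past {at k} (legal k)) (cong (out k ∷_) (past-hist k))

      NewDigit : ℕ → List ℕ → Set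
      NewDigit k₀ α = ∃[ k ] (k₀ < k × Live (past (at k)) (digits (at k)) ×
                              suc (length α) ≤ length (digits (at k)))

      mutual
        -- Induction on the plan: being well-founded, it cannot postpone its goal forever, whichever
        -- of its answers are followed.
        newDigit : ∀ {s α} (d : Reach (NextLive α) X s) k → at k ≡ state s α d → NewDigit k α
        newDigit {s} {α} (step answer) k eq with subst (λ q → Legal q (Z k) (out k , at (suc k))) eq (legal k)
        ... | _ , Y , p , eq′ = newDigit-answer (answer Y p) k (cong proj₂ eq′)

        newDigit-answer : ∀ {s α d Y} (x : Σ[ v ∈ ℕ ] (v ∈ Y × (NextLive α (v ∷ s) ⊎ Reach (NextLive α) X (v ∷ s)))) k →
          at (suc k) ≡ proj₂ (perform (state s α d) (proj₁ x , proj₂ (proj₂ x))) → NewDigit k α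
        newDigit-answer {s} {α} (v , _ , inj₁ (a , live)) k eq = suc k , ≤-refl ,
          subst (λ q → Live (past q) (digits q)) (sym eq) live ,
          ≤-reflexive (sym (cong (length ∘ digits) eq))
        newDigit-answer (v , _ , inj₂ d) k eq with newDigit d (suc k) eq
        ... | k′ , k<k′ , rest = k′ , <-trans ≤-refl k<k′ , rest

      newDigit-after : ∀ k → NewDigit k (digits (at k))
      newDigit-after k = newDigit (plan (at k)) k refl

      long : ∀ n → ∃[ k ] n ≤ length (digits (at k))
      long zero    = 0 , z≤n
      long (suc n) with long n
      ... | k , n≤ with newDigit-after k
      ... | k′ , _ , _ , longer = k′ , ≤-trans (s≤s n≤) longer

      open Limit.Along 0 (λ k → digits (at k)) (λ k → legal-digits {at k} (legal k)) long public
        using () renaming (limit to witness; hist-limit to hist-witness; monotone-≤ to digits-mono)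

      recurrent : ∀ n → ∃[ k ] ∃[ j ] (n ≤ k × n ≤ j × Live (hist out k) (hist witness j))
      recurrent n with long n
      ... | k₁ , n≤ with newDigit-after (k₁ ⊔ n)
      ... | k , k₁⊔n<k , live , longer = k , length (digits (at k)) ,
        ≤-trans (m≤n⊔m k₁ n) (<⇒≤ k₁⊔n<k) ,
        ≤-trans n≤ (⊒-length (digits-mono (≤-trans (m≤m⊔n k₁ n) (<⇒≤ k₁⊔n<k)))) ,
        subst₂ Live (past-hist k) (sym (hist-witness k)) live

      out-∈ : ∀ k → out k ∈ Z k
      out-∈ k = legal-∈ {at k} (legal k)

-- Linear algebra

module VectorSpaces where
  open import Data.Nat.Base using (_≤_; _<_)
  open import Data.Nat.Properties
    using (≤-refl; ≤-trans; ≤-<-trans; <-≤-trans; <-trans; <⇒≤; <⇒≱; ≰⇒>; m≤n⇒m<n∨m≡n; m≤n+m)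
  open Combinatorics

  module LinearAlgebra {F : CommutativeRing 0ℓ 0ℓ} (E : Module F 0ℓ 0ℓ) where
    open CommutativeRing F hiding (_≉_; zero)
    open Module E
    module R = SetoidReasoning ≈ᴹ-setoid

    -- Common to spans, to the vectors supported beyond a given index and to the mixed spans `Mix`;
    -- inclusions of spans are then checked on generators.
    record IsSubmodule (P : Pred Carrierᴹ 0ℓ) : Set where
      field
        respects : ∀ {v w} → v ≈ᴹ w → P v → P w
        0∈       : P 0ᴹ
        +-closed : ∀ {v w} → P v → P w → P (v +ᴹ w)
        ∗-closed : ∀ a {v} → P v → P (a *ₗ v)

      combination-closed : ∀ x as → (∀ i → i < length as → P (x i)) → P (combination E x as)
      combination-closed x []       gens = 0∈
      combination-closed x (a ∷ as) gens = +-closed (∗-closed a (gens 0 (s≤s z≤n)))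
        (combination-closed (x ∘ suc) as λ i i< → gens (suc i) (s≤s i<))

      span-⊆ : ∀ {x} → (∀ i → P (x i)) → Span E x ⊆ P
      span-⊆ {x} gens (as , eq) = respects eq (combination-closed x as λ i _ → gens i)

    +ᴹ-interchange : ∀ p q r s → (p +ᴹ q) +ᴹ (r +ᴹ s) ≈ᴹ (p +ᴹ r) +ᴹ (q +ᴹ s)
    +ᴹ-interchange p q r s = R.begin
      (p +ᴹ q) +ᴹ (r +ᴹ s) R.≈⟨ +ᴹ-assoc p q _ ⟩
      p +ᴹ (q +ᴹ (r +ᴹ s)) R.≈⟨ +ᴹ-congˡ (≈ᴹ-sym (+ᴹ-assoc q r s)) ⟩
      p +ᴹ ((q +ᴹ r) +ᴹ s) R.≈⟨ +ᴹ-congˡ (+ᴹ-congʳ (+ᴹ-comm q r)) ⟩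
      p +ᴹ ((r +ᴹ q) +ᴹ s) R.≈⟨ +ᴹ-congˡ (+ᴹ-assoc r q s) ⟩
      p +ᴹ (r +ᴹ (q +ᴹ s)) R.≈⟨ ≈ᴹ-sym (+ᴹ-assoc p r _) ⟩
      (p +ᴹ r) +ᴹ (q +ᴹ s) R.∎

    add : List Carrier → List Carrier → List Carrier
    add []       bs       = bs
    add (a ∷ as) []       = a ∷ as
    add (a ∷ as) (b ∷ bs) = (a + b) ∷ add as bs

    combination-add : ∀ x as bs → combination E x (add as bs) ≈ᴹ combination E x as +ᴹ combination E x bs
    combination-add x []       bs       = ≈ᴹ-sym (+ᴹ-identityˡ _)
    combination-add x (a ∷ as) []       = ≈ᴹ-sym (+ᴹ-identityʳ _)
    combination-add x (a ∷ as) (b ∷ bs) = R.begin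
      (a + b) *ₗ x 0 +ᴹ combination E (x ∘ suc) (add as bs)
        R.≈⟨ +ᴹ-cong (*ₗ-distribʳ (x 0) a b) (combination-add (x ∘ suc) as bs) ⟩
      (a *ₗ x 0 +ᴹ b *ₗ x 0) +ᴹ (v +ᴹ w)
        R.≈⟨ +ᴹ-interchange _ _ _ _ ⟩
      (a *ₗ x 0 +ᴹ v) +ᴹ (b *ₗ x 0 +ᴹ w) R.∎
      where
      v = combination E (x ∘ suc) as
      w = combination E (x ∘ suc) bs

    combination-scale : ∀ c x as → combination E x (map (c *_) as) ≈ᴹ c *ₗ combination E x as
    combination-scale c x []       = ≈ᴹ-sym (*ₗ-zeroʳ c)
    combination-scale c x (a ∷ as) = R.begin
      (c * a) *ₗ x 0 +ᴹ combination E (x ∘ suc) (map (c *_) as)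
        R.≈⟨ +ᴹ-cong (*ₗ-assoc c a (x 0)) (combination-scale c (x ∘ suc) as) ⟩
      c *ₗ (a *ₗ x 0) +ᴹ c *ₗ combination E (x ∘ suc) as
        R.≈⟨ ≈ᴹ-sym (*ₗ-distribˡ c _ _) ⟩
      c *ₗ (a *ₗ x 0 +ᴹ combination E (x ∘ suc) as) R.∎

    span-isSubmodule : ∀ x → IsSubmodule (Span E x)
    span-isSubmodule x = record
      { respects = λ { eq (as , p) → as , ≈ᴹ-trans p eq }
      ; 0∈       = [] , ≈ᴹ-refl
      ; +-closed = λ { (as , p) (bs , q) → add as bs , ≈ᴹ-trans (combination-add x as bs) (+ᴹ-cong p q) }
      ; ∗-closed = λ { c (as , p) → map (c *_) as , ≈ᴹ-trans (combination-scale c x as) (*ₗ-congˡ p) }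
      }

    unit : ℕ → List Carrier
    unit zero    = 1# ∷ []
    unit (suc n) = 0# ∷ unit n

    combination-unit : ∀ x n → combination E x (unit n) ≈ᴹ x n
    combination-unit x zero    = ≈ᴹ-trans (+ᴹ-identityʳ _) (*ₗ-identityˡ (x 0))
    combination-unit x (suc n) =
      ≈ᴹ-trans (+ᴹ-cong (*ₗ-zeroˡ (x 0)) (combination-unit (x ∘ suc) n)) (+ᴹ-identityˡ _)

    ∈-span : ∀ x n → Span E x (x n)
    ∈-span x n = unit n , combination-unit x n

    enumerate-combinations : ∀ x as (φ : ℕ → Carrier) → (∀ a → ∃[ n ] φ n ≈ a) → ∃[ l ] combination E x (map φ l) ≈ᴹ combination E x as
    enumerate-combinations x []       φ onto = [] , ≈ᴹ-refl
    enumerate-combinations x (a ∷ as) φ onto with onto a | enumerate-combinations (x ∘ suc) as φ onto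
    ... | n , eq | l , eq′ = n ∷ l , +ᴹ-cong (*ₗ-congʳ eq) eq′

  -- Supports, block subspaces and codes of vectors

  module BlockSubspaces (em : ExcludedMiddle 0ℓ) {F : CommutativeRing 0ℓ 0ℓ} (field′ : IsField F)
    (countable : Countable F) (E : Module F 0ℓ 0ℓ) {e : ℕ → Module.Carrierᴹ E} (basis : IsBasis E e) where
    open CommutativeRing F hiding (_≉_; zero)
    open Module E
    open IsBasis basis
    open IsField field′
    open BlockSequences E basis
    open LinearAlgebra E
    open RingProperties ring using (-1*x≈-x; -‿involutive; +-inverseˡ-unique)
    module RF = SetoidReasoning setoid

    entry-add : ∀ as bs i → entry (add as bs) i ≈ entry as i + entry bs i
    entry-add []       bs       i       = sym (+-identityˡ _)
    entry-add (a ∷ as) []       i       = sym (+-identityʳ _)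
    entry-add (a ∷ as) (b ∷ bs) zero    = refl
    entry-add (a ∷ as) (b ∷ bs) (suc i) = entry-add as bs i

    entry-scale : ∀ c as i → entry (map (c *_) as) i ≈ c * entry as i
    entry-scale c []       i       = sym (zeroʳ c)
    entry-scale c (a ∷ as) zero    = refl
    entry-scale c (a ∷ as) (suc i) = entry-scale c as i

    entry-zero : ∀ as → All (_≈ 0#) as → ∀ i → entry as i ≈ 0#
    entry-zero []       []       i       = refl
    entry-zero (a ∷ as) (p ∷ ps) zero    = p
    entry-zero (a ∷ as) (p ∷ ps) (suc i) = entry-zero as ps i

    entry-beyond : ∀ as {i} → length as ≤ i → entry as i ≈ 0#
    entry-beyond []       _       = refl
    entry-beyond (a ∷ as) (s≤s p) = entry-beyond as p

    -- Independence is applied to `add as (map (- 1# *_) bs)`, the coefficients of the difference.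
    entry-unique : ∀ as bs → combination E e as ≈ᴹ combination E e bs → ∀ i → entry as i ≈ entry bs i
    entry-unique as bs eq i = RF.begin
      entry as i             RF.≈⟨ +-inverseˡ-unique _ _ vanishes ⟩
      - (- 1# * entry bs i)  RF.≈⟨ -‿cong (-1*x≈-x _) ⟩
      - (- entry bs i)       RF.≈⟨ -‿involutive _ ⟩
      entry bs i             RF.∎
      where
      difference : combination E e (add as (map (- 1# *_) bs)) ≈ᴹ 0ᴹ
      difference = R.begin
        combination E e (add as (map (- 1# *_) bs))      R.≈⟨ combination-add e as _ ⟩
        combination E e as +ᴹ combination E e (map (- 1# *_) bs)
          R.≈⟨ +ᴹ-cong eq (combination-scale (- 1#) e bs) ⟩
        w +ᴹ (- 1#) *ₗ w                                  R.≈⟨ +ᴹ-congʳ (≈ᴹ-sym (*ₗ-identityˡ w)) ⟩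
        1# *ₗ w +ᴹ (- 1#) *ₗ w                            R.≈⟨ ≈ᴹ-sym (*ₗ-distribʳ w 1# (- 1#)) ⟩
        (1# + - 1#) *ₗ w                                  R.≈⟨ *ₗ-congʳ (-‿inverseʳ 1#) ⟩
        0# *ₗ w                                           R.≈⟨ *ₗ-zeroˡ w ⟩
        0ᴹ R.∎
        where w = combination E e bs
      vanishes : entry as i + - 1# * entry bs i ≈ 0#
      vanishes = trans (sym (trans (entry-add as (map (- 1# *_) bs) i) (+-congˡ (entry-scale (- 1#) bs i))))
                       (entry-zero (add as (map (- 1# *_) bs)) (independent _ difference) i)

    coefficient-combination : ∀ as {v} → combination E e as ≈ᴹ v → ∀ i → coefficient v i ≈ entry as i
    coefficient-combination as {v} eq =
      entry-unique (proj₁ (spanning v)) as (≈ᴹ-trans (proj₂ (spanning v)) (≈ᴹ-sym eq))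

    coefficient-cong : ∀ {v w} → v ≈ᴹ w → ∀ i → coefficient v i ≈ coefficient w i
    coefficient-cong {v} {w} eq = coefficient-combination (proj₁ (spanning w))
      (≈ᴹ-trans (proj₂ (spanning w)) (≈ᴹ-sym eq))

    coefficient-0 : ∀ i → coefficient 0ᴹ i ≈ 0#
    coefficient-0 = coefficient-combination [] ≈ᴹ-refl

    coefficient-+ : ∀ v w i → coefficient (v +ᴹ w) i ≈ coefficient v i + coefficient w i
    coefficient-+ v w i = trans
      (coefficient-combination (add as bs)
        (≈ᴹ-trans (combination-add e as bs) (+ᴹ-cong (proj₂ (spanning v)) (proj₂ (spanning w)))) i)
      (entry-add as bs i)
      where
      as = proj₁ (spanning v)
      bs = proj₁ (spanning w)

    coefficient-* : ∀ a v i → coefficient (a *ₗ v) i ≈ a * coefficient v i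
    coefficient-* a v i = trans
      (coefficient-combination (map (a *_) (proj₁ (spanning v)))
        (≈ᴹ-trans (combination-scale a e (proj₁ (spanning v))) (*ₗ-congˡ (proj₂ (spanning v)))) i)
      (entry-scale a (proj₁ (spanning v)) i)

    zero-coefficients : ∀ x as → (∀ i → entry as i ≈ 0#) → combination E x as ≈ᴹ 0ᴹ
    zero-coefficients x []       zeros = ≈ᴹ-refl
    zero-coefficients x (a ∷ as) zeros = ≈ᴹ-trans
      (+ᴹ-cong (≈ᴹ-trans (*ₗ-congʳ (zeros 0)) (*ₗ-zeroˡ (x 0)))
               (zero-coefficients (x ∘ suc) as (zeros ∘ suc)))
      (+ᴹ-identityˡ 0ᴹ)

    supp-nonempty : ∀ {v} → ¬ (v ≈ᴹ 0ᴹ) → ∃[ i ] supp v i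
    supp-nonempty {v} v≉0 with em {∃[ i ] supp v i}
    ... | yes found = found
    ... | no none   = ⊥-elim (v≉0 (≈ᴹ-trans (≈ᴹ-sym (proj₂ (spanning v)))
                        (zero-coefficients e (proj₁ (spanning v)) zeros)))
      where
      zeros : ∀ i → coefficient v i ≈ 0#
      zeros i with em {coefficient v i ≈ 0#}
      ... | yes z  = z
      ... | no ¬z  = ⊥-elim (none (i , ¬z))

    suppBound : Carrierᴹ → ℕ
    suppBound v = length (proj₁ (spanning v))

    supp-< : ∀ {v i} → supp v i → i < suppBound v
    supp-< {v} s = ≰⇒> λ b≤i → s (entry-beyond (proj₁ (spanning v)) b≤i)

    -- The positive form of `n <min-supp v`, in which closure under linear combinations is
    -- immediate; excluded middle recovers it from the negative form.
    Above : ℕ → Pred Carrierᴹ 0ℓ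
    Above n v = ∀ i → i ≤ n → coefficient v i ≈ 0#

    above⇒<min-supp : ∀ {n v} → Above n v → n <min-supp v
    above⇒<min-supp above i s = ≰⇒> λ i≤n → s (above i i≤n)

    <min-supp⇒above : ∀ {n v} → n <min-supp v → Above n v
    <min-supp⇒above {n} {v} n< i i≤n with em {coefficient v i ≈ 0#}
    ... | yes z = z
    ... | no ¬z = ⊥-elim (<⇒≱ (n< i ¬z) i≤n)

    above-isSubmodule : ∀ n → IsSubmodule (Above n)
    above-isSubmodule n = record
      { respects = λ eq above i i≤n → trans (sym (coefficient-cong eq i)) (above i i≤n)
      ; 0∈       = λ i _ → coefficient-0 i
      ; +-closed = λ {v} {w} p q i i≤n → trans (coefficient-+ v w i)
                     (trans (+-cong (p i i≤n) (q i i≤n)) (+-identityˡ 0#))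
      ; ∗-closed = λ a {v} p i i≤n → trans (coefficient-* a v i) (trans (*-congˡ (p i i≤n)) (zeroʳ a))
      }

    term-<ˢ : ∀ X {m n} → m < n → term X m <ˢ term X n
    term-<ˢ X {m} {suc n} (s≤s m≤n) with m≤n⇒m<n∨m≡n m≤n
    ... | inj₂ ≡.refl = block X m
    ... | inj₁ m<n    = λ i i∈ j j∈ →
      let (k , k∈) = supp-nonempty (nonzero X n)
      in <-trans (term-<ˢ X m<n i i∈ k k∈) (block X n k k∈ j j∈)

    index-≤-supp : ∀ X n {i} → supp (term X n) i → n ≤ i
    index-≤-supp X zero    _  = z≤n
    index-≤-supp X (suc n) i∈ =
      let (k , k∈) = supp-nonempty (nonzero X n)
      in ≤-<-trans (index-≤-supp X n k∈) (block X n k k∈ _ i∈)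

    drop : ℕ → E^[∞] → E^[∞]
    drop k X = record { term = λ n → term X (n ℕ.+ k) ; nonzero = λ n → nonzero X (n ℕ.+ k) ; block = λ n → block X (n ℕ.+ k) }

    rest : E^[∞] → E^[∞]
    rest X = record { term = term X ∘ suc ; nonzero = nonzero X ∘ suc ; block = block X ∘ suc }

    term∈ : ∀ X n → ⟨ X ⟩ (term X n)
    term∈ X n = ∈-span (term X) n

    ⟨⟩-isSubmodule : ∀ X → IsSubmodule ⟨ X ⟩
    ⟨⟩-isSubmodule X = span-isSubmodule (term X)

    drop-above : ∀ X n → ⟨ drop (suc n) X ⟩ ⊆ Above n
    drop-above X n = span-⊆ λ i → <min-supp⇒above λ j j∈ →
      ≤-trans (m≤n+m (suc n) i) (index-≤-supp X (i ℕ.+ suc n) j∈)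
      where open IsSubmodule (above-isSubmodule n)

    integral : ∀ {a c} → ¬ (c ≈ 0#) → a * c ≈ 0# → a ≈ 0#
    integral {a} {c} c≉0 ac≈0 = let (b , cb≈1) = inverse c c≉0 in RF.begin
      a            RF.≈⟨ sym (*-identityʳ a) ⟩
      a * 1#       RF.≈⟨ *-congˡ (sym cb≈1) ⟩
      a * (c * b)  RF.≈⟨ sym (*-assoc a c b) ⟩
      (a * c) * b  RF.≈⟨ *-congʳ ac≈0 ⟩
      0# * b       RF.≈⟨ zeroˡ b ⟩
      0# RF.∎

    -- The supports of the first `m` terms lie below `i`, where `v` vanishes. Since the supports of
    -- the terms are disjoint, the coefficients of these terms in `v` are `0`, and they are stripped
    -- off one by one.
    tail-closed : ∀ {P} → IsSubmodule P → ∀ m Y i → (∀ j → j < m → suppBound (term Y j) ≤ i) →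
                  (∀ j → m ≤ j → P (term Y j)) → ∀ {v} → Above i v → ⟨ Y ⟩ v → P v
    tail-closed sub zero    Y i bounds gens above v∈ = IsSubmodule.span-⊆ sub (λ j → gens j z≤n) v∈
    tail-closed sub (suc m) Y i bounds gens above ([] , eq) = IsSubmodule.respects sub eq (IsSubmodule.0∈ sub)
    tail-closed sub (suc m) Y i bounds gens {v} above (a ∷ as , eq) =
      tail-closed sub m (rest Y) i (λ j j<m → bounds (suc j) (s≤s j<m)) (λ j m≤j → gens (suc j) (s≤s m≤j))
        above (as , ≈ᴹ-trans (≈ᴹ-sym (≈ᴹ-trans (+ᴹ-congʳ (≈ᴹ-trans (*ₗ-congʳ a≈0) (*ₗ-zeroˡ _))) (+ᴹ-identityˡ w))) eq)
      where
      w = combination E (term Y ∘ suc) as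
      y = term Y 0
      k   = proj₁ (supp-nonempty (nonzero Y 0))
      k∈  = proj₂ (supp-nonempty (nonzero Y 0))
      w-above : Above k w
      w-above = IsSubmodule.combination-closed (above-isSubmodule k) (term Y ∘ suc) as λ n _ →
        <min-supp⇒above (term-<ˢ Y (s≤s z≤n) k k∈)
      a≈0 : a ≈ 0#
      -- Compare coefficients at an index `k` in the support of the first term: all later terms
      -- vanish there, and so does `v`.
      a≈0 = integral k∈ (RF.begin
        a * coefficient y k                       RF.≈⟨ sym (+-identityʳ _) ⟩
        a * coefficient y k + 0#                  RF.≈⟨ +-cong (sym (coefficient-* a y k)) (sym (w-above k ≤-refl)) ⟩
        coefficient (a *ₗ y) k + coefficient w k  RF.≈⟨ sym (coefficient-+ (a *ₗ y) w k) ⟩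
        coefficient (a *ₗ y +ᴹ w) k               RF.≈⟨ coefficient-cong eq k ⟩
        coefficient v k                           RF.≈⟨ above k (≤-trans (<⇒≤ (supp-< k∈)) (bounds 0 (s≤s z≤n))) ⟩
        0# RF.∎)

    scalar : ℕ → Carrier
    scalar = Surjection.to countable

    scalar-onto : ∀ a → ∃[ n ] scalar n ≈ a
    scalar-onto a = let (n , eq) = Surjection.surjective countable a in n , eq ≡.refl

    abstract
      -- Countability of the field enters here. A vector has many codes; a canonical one is singled
      -- out only where strategies must respect `≈ᴹ`.
      vec : ℕ → Carrierᴹ
      vec n = combination E e (map scalar (proj₁ List-enumeration n))

      vec-onto : ∀ v → ∃[ n ] vec n ≈ᴹ v
      vec-onto v with enumerate-combinations e (proj₁ (spanning v)) scalar scalar-onto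
      ... | l , eq with proj₂ List-enumeration l
      ... | n , ≡.refl = n , ≈ᴹ-trans eq (proj₂ (spanning v))

    code : Carrierᴹ → ℕ
    code v = proj₁ (vec-onto v)

    vec-code : ∀ v → vec (code v) ≈ᴹ v
    vec-code v = proj₂ (vec-onto v)

    Mix : List ℕ → E^[∞] → Pred Carrierᴹ 0ℓ
    Mix []       Z v = ⟨ Z ⟩ v
    Mix (z ∷ zs) Z v = Σ[ a ∈ Carrier ] Σ[ w ∈ Carrierᴹ ] (Mix zs Z w × (a *ₗ vec z +ᴹ w) ≈ᴹ v)

    weaken : ∀ z zs Z → Mix zs Z ⊆ Mix (z ∷ zs) Z
    weaken z zs Z {v} v∈ = 0# , v , v∈ , ≈ᴹ-trans (+ᴹ-congʳ (*ₗ-zeroˡ _)) (+ᴹ-identityˡ v)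

    mix-isSubmodule : ∀ zs Z → IsSubmodule (Mix zs Z)
    mix-isSubmodule []       Z = ⟨⟩-isSubmodule Z
    mix-isSubmodule (z ∷ zs) Z = record
      { respects = λ { eq (a , w , w∈ , p) → a , w , w∈ , ≈ᴹ-trans p eq }
      ; 0∈       = weaken z zs Z 0∈
      ; +-closed = λ { (a , w , w∈ , p) (b , x , x∈ , q) → a + b , w +ᴹ x , +-closed w∈ x∈ ,
          ≈ᴹ-trans (≈ᴹ-trans (+ᴹ-congʳ (*ₗ-distribʳ _ a b)) (+ᴹ-interchange _ _ _ _)) (+ᴹ-cong p q) }
      ; ∗-closed = λ { c (a , w , w∈ , p) → c * a , c *ₗ w , ∗-closed c w∈ ,
          ≈ᴹ-trans (≈ᴹ-trans (+ᴹ-congʳ (*ₗ-assoc c a _)) (≈ᴹ-sym (*ₗ-distribˡ c _ _))) (*ₗ-congˡ p) }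
      }
      where open IsSubmodule (mix-isSubmodule zs Z)

    mix-mono : ∀ zs {Y Z} → ⟨ Y ⟩ ⊆ ⟨ Z ⟩ → Mix zs Y ⊆ Mix zs Z
    mix-mono []       Y⊆Z v∈               = Y⊆Z v∈
    mix-mono (z ∷ zs) Y⊆Z (a , w , w∈ , p) = a , w , mix-mono zs Y⊆Z w∈ , p

    ⟨⟩⊆mix : ∀ zs Z → ⟨ Z ⟩ ⊆ Mix zs Z
    ⟨⟩⊆mix []       Z v∈ = v∈
    ⟨⟩⊆mix (z ∷ zs) Z v∈ = weaken z zs Z (⟨⟩⊆mix zs Z v∈)

    rest⊆ : ∀ Z → ⟨ rest Z ⟩ ⊆ ⟨ Z ⟩
    rest⊆ Z = IsSubmodule.span-⊆ (⟨⟩-isSubmodule Z) λ i → term∈ Z (suc i)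

    hist-∈-mix : ∀ (z : ℕ → ℕ) W m {i} → i < m → Mix (hist z m) W (vec (z i))
    hist-∈-mix z W (suc m) {i} i<1+m with m≤n⇒m<n∨m≡n i<1+m
    ... | inj₁ (s≤s i<m) = weaken (z m) (hist z m) W (hist-∈-mix z W m i<m)
    ... | inj₂ ≡.refl    = 1# , 0ᴹ , IsSubmodule.0∈ (mix-isSubmodule (hist z m) W) ,
                           ≈ᴹ-trans (+ᴹ-identityʳ _) (*ₗ-identityˡ _)

    module Heads (Z : ℕ → E^[∞]) (beyond : ∀ n → ⟨ Z (suc n) ⟩ ⊆ Above (suppBound (term (Z n) 0))) where

      heads : E^[∞]
      heads = record
        { term    = λ n → term (Z n) 0
        ; nonzero = λ n → nonzero (Z n) 0
        ; block   = λ n i i∈ j j∈ → <-trans (supp-< i∈)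
            (above⇒<min-supp (beyond n (term∈ (Z (suc n)) 0)) j j∈)
        }

      heads-⊆ : ∀ {P} → IsSubmodule P → (∀ n → ⟨ Z n ⟩ ⊆ P) → ⟨ heads ⟩ ⊆ P
      heads-⊆ sub Z⊆ = IsSubmodule.span-⊆ sub λ n → Z⊆ n (term∈ (Z n) 0)

      eventually-⊆ : ∀ {P} → IsSubmodule P → ∀ m → (∀ n → m ≤ n → ⟨ Z n ⟩ ⊆ P) →
                     ∀ {v} → Above (maxUpto m λ n → suppBound (term (Z n) 0)) v → ⟨ heads ⟩ v → P v
      eventually-⊆ sub m Z⊆ = tail-closed sub m heads _ (λ j j<m → ≤-maxUpto _ (<⇒≤ j<m))
                                λ n m≤n → Z⊆ n m≤n (term∈ (Z n) 0)

      heads-mix : ∀ {v} → ⟨ heads ⟩ v → ∃[ n ] (∀ m → n ≤ m → ∀ W →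
                  Mix (hist (λ k → code (term (Z k) 0)) m) W v)
      heads-mix (as , eq) = length as , λ m n≤m W →
        let sub = mix-isSubmodule (hist (λ k → code (term (Z k) 0)) m) W in
        IsSubmodule.respects sub eq (IsSubmodule.combination-closed sub (term heads) as λ i i< →
          IsSubmodule.respects sub (vec-code (term (Z i) 0))
            (hist-∈-mix (λ k → code (term (Z k) 0)) W m (<-≤-trans i< n≤m)))

    -- `BlockSpace` sees only codes. Every vector is `≈ᴹ` to a coded one and submodules respect
    -- `≈ᴹ`, so inclusions on codes are true inclusions.
    decode-⊆ : ∀ {P Q} → IsSubmodule P → IsSubmodule Q → (∀ {v} → P (vec v) → Q (vec v)) → P ⊆ Q
    decode-⊆ P-sub Q-sub p⇒q {w} p = IsSubmodule.respects Q-sub (vec-code w)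
      (p⇒q (IsSubmodule.respects P-sub (≈ᴹ-sym (vec-code w)) p))

    stairs : (Z : ℕ → E^[∞]) →
      (∀ n {v} → ⟨ Z (suc n) ⟩ (vec v) → suppBound (term (Z n) 0) <min-supp vec v) →
      ∀ n → ⟨ Z (suc n) ⟩ ⊆ Above (suppBound (term (Z n) 0))
    stairs Z s n = decode-⊆ (⟨⟩-isSubmodule (Z (suc n))) (above-isSubmodule _)
                     λ v∈ → <min-supp⇒above (s n v∈)

    blockSpace : BlockSpace
    blockSpace = record
      { 𝕏        = E^[∞]
      ; _∈_      = λ v X → ⟨ X ⟩ (vec v)
      ; _≫_      = λ v n → n <min-supp vec v
      ; _∈_⊕_    = λ v zs Z → Mix zs Z (vec v)
      ; ≫-anti   = λ m≤n n< i i∈ → ≤-<-trans m≤n (n< i i∈)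
      -- Supports start at `m` or later in the `m`-th term, so dropping `suc n` terms leaves only
      -- supports strictly beyond `n`.
      ; tail     = λ X n → drop (suc n) X
      ; tail-⪯   = λ X n → IsSubmodule.span-⊆ (⟨⟩-isSubmodule X) λ i → term∈ X (i ℕ.+ suc n)
      ; tail-≫   = λ X n v∈ → above⇒<min-supp (drop-above X n v∈)
      ; []⊕      = id
      ; ⊕-mono   = λ {Y} {Z} Y⪯Z {zs} → mix-mono zs (decode-⊆ (⟨⟩-isSubmodule Y) (⟨⟩-isSubmodule Z) Y⪯Z)
      ; []⊕⁻¹    = id
      ; hd       = λ Z → code (term Z 0)
      ; tl       = rest
      ; tl-⪯     = λ Z → rest⊆ Z
      ; ⊕-hd     = λ { {Z} {zs} (a , w , w∈ , p) → let open IsSubmodule (mix-isSubmodule zs Z) in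
          respects p (+-closed
            (∗-closed a (respects (≈ᴹ-sym (vec-code (term Z 0))) (⟨⟩⊆mix zs Z (term∈ Z 0))))
            (mix-mono zs (rest⊆ Z) w∈)) }
      ; bound    = λ Z → suppBound (term Z 0)
      ; heads    = λ Z s → Heads.heads Z (stairs Z s)
      ; heads-⪯  = λ Z s {X} Z⪯ → Heads.heads-⊆ Z (stairs Z s) (⟨⟩-isSubmodule X) λ n →
          decode-⊆ (⟨⟩-isSubmodule (Z n)) (⟨⟩-isSubmodule X) (Z⪯ n)
      ; heads-⪯* = λ Z s {X} m Z⪯ → _ , λ v∈ v≫ →
          Heads.eventually-⊆ Z (stairs Z s) (⟨⟩-isSubmodule X) m
            (λ n m≤n → decode-⊆ (⟨⟩-isSubmodule (Z n)) (⟨⟩-isSubmodule X) (Z⪯ n m≤n))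
            (<min-supp⇒above v≫) v∈
      ; heads-⊕  = λ Z s → Heads.heads-mix Z (stairs Z s)
      }

    entry-unit : ∀ n {i} → ¬ (entry (unit n) i ≈ 0#) → i ≡ n
    entry-unit zero    {zero}  _ = ≡.refl
    entry-unit zero    {suc i} s = ⊥-elim (s refl)
    entry-unit (suc n) {zero}  s = ⊥-elim (s refl)
    entry-unit (suc n) {suc i} s = ≡.cong suc (entry-unit n s)

    entry-unit-1 : ∀ n → entry (unit n) n ≡ 1#
    entry-unit-1 zero    = ≡.refl
    entry-unit-1 (suc n) = entry-unit-1 n

    coefficient-e : ∀ n i → coefficient (e n) i ≈ entry (unit n) i
    coefficient-e n = coefficient-combination (unit n) (combination-unit e n)

    supp-e : ∀ n {i} → supp (e n) i → i ≡ n
    supp-e n {i} i∈ = entry-unit n λ z → i∈ (trans (coefficient-e n i) z)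

    basisSequence : E^[∞]
    basisSequence = record
      { term    = e
      ; nonzero = λ n e≈0 → nontrivial (sym (RF.begin
          1#                RF.≡⟨ entry-unit-1 n ⟨
          entry (unit n) n  RF.≈⟨ sym (coefficient-e n n) ⟩
          coefficient (e n) n RF.≈⟨ coefficient-cong e≈0 n ⟩
          coefficient 0ᴹ n  RF.≈⟨ coefficient-0 n ⟩
          0# RF.∎))
      ; block   = λ n i i∈ j j∈ → ≡.subst₂ _<_ (≡.sym (supp-e n i∈)) (≡.sym (supp-e (suc n) j∈)) ≤-refl
      }

-- A Cantor set in the real line

module RealLine where
  open import Data.Rational.Base
    using (ℚ; mkℚ; 0ℚ; 1ℚ; ½; _+_; _*_; _-_; -_; _/_; ∣_∣; _≤_; _<_; toℚᵘ; *<*)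
  open import Data.Rational.Properties
  open import Relation.Binary.PropositionalEquality
  open +-*-Solver using (solve; _:+_; _:*_; _:-_; :-_; _:=_; con)
  open Combinatorics

  ¼ ¾ : ℚ
  ¼ = ℤ.+ 1 / 4
  ¾ = ℤ.+ 3 / 4

  ∣-∣-sym : ∀ p q → ∣ p - q ∣ ≡ ∣ q - p ∣
  ∣-∣-sym p q = trans (sym (∣-p∣≡∣p∣ (p - q)))
    (cong ∣_∣ (solve 2 (λ p q → :- (p :- q) := q :- p) refl p q))

  ∣-∣-triangle : ∀ p q r → ∣ p - r ∣ ≤ ∣ p - q ∣ + ∣ q - r ∣
  ∣-∣-triangle p q r = subst (λ x → ∣ x ∣ ≤ ∣ p - q ∣ + ∣ q - r ∣)
    (solve 3 (λ p q r → (p :- q) :+ (q :- r) := p :- r) refl p q r)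
    (∣p+q∣≤∣p∣+∣q∣ (p - q) (q - r))

  ∣-∣-diagonal : ∀ p → ∣ p - p ∣ ≤ 0ℚ
  ∣-∣-diagonal p = ≤-reflexive (cong ∣_∣ (+-inverseʳ p))

  ≤-∣∣ : ∀ p → p ≤ ∣ p ∣
  ≤-∣∣ p with ≤-total 0ℚ p
  ... | inj₁ 0≤p = ≤-reflexive (sym (0≤p⇒∣p∣≡p 0≤p))
  ... | inj₂ p≤0 = ≤-trans p≤0 (0≤∣p∣ p)

  ∣∣-≤ : ∀ {p r} → - r ≤ p → p ≤ r → ∣ p ∣ ≤ r
  ∣∣-≤ {p} {r} -r≤p p≤r with ∣p∣≡p∨∣p∣≡-p p
  ... | inj₁ eq = ≤-trans (≤-reflexive eq) p≤r
  ... | inj₂ eq = ≤-trans (≤-reflexive eq)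
    (≤-trans (neg-antimono-≤ -r≤p) (≤-reflexive (solve 1 (λ r → :- (:- r) := r) refl r)))

  ∣¼∗∣ : ∀ p → ∣ ¼ * p ∣ ≡ ¼ * ∣ p ∣
  ∣¼∗∣ p = ∣p*q∣≡∣p∣*∣q∣ ¼ p

  recip : ℕ → ℚ
  recip n = ℤ.+ 1 / suc n

  toℚᵘ-recip : ∀ n → toℚᵘ (recip n) ℚᵘ.≃ ℚᵘ.mkℚᵘ (ℤ.+ 1) n
  toℚᵘ-recip n = toℚᵘ-fromℚᵘ (ℚᵘ.mkℚᵘ (ℤ.+ 1) n)

  recip-≤ : ∀ n {p} → ℚᵘ.mkℚᵘ (ℤ.+ 1) n ℚᵘ.≤ toℚᵘ p → recip n ≤ p
  recip-≤ n le = toℚᵘ-cancel-≤ (ℚᵘₚ.≤-trans (ℚᵘₚ.≤-reflexive (toℚᵘ-recip n)) le)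

  recip-anti : ∀ {m n} → m ℕ.≤ n → recip n ≤ recip m
  recip-anti {m} {n} m≤n = recip-≤ n (ℚᵘₚ.≤-trans
    (ℚᵘ.*≤* (ℤ.+≤+ (s≤s (ℕₚ.+-monoˡ-≤ 0 m≤n))))
    (ℚᵘₚ.≤-reflexive (ℚᵘₚ.≃-sym (toℚᵘ-recip m))))

  recip-positive : ∀ n → 0ℚ < recip n
  recip-positive n = toℚᵘ-cancel-< (ℚᵘₚ.<-≤-trans (ℚᵘ.*<* (ℤ.+<+ (s≤s z≤n)))
    (ℚᵘₚ.≤-reflexive (ℚᵘₚ.≃-sym (toℚᵘ-recip n))))

  archimedean : ∀ p → 0ℚ < p → ∃[ n ] recip n ≤ p
  archimedean (mkℚ (ℤ.+ suc k) d _) _ = d , recip-≤ d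
    (ℚᵘ.*≤* (ℤ.+≤+ (ℕₚ.*-monoˡ-≤ (suc d) (s≤s (z≤n {k})))))
  archimedean (mkℚ (ℤ.+ zero) d _) (*<* (ℤ.+<+ ()))
  archimedean (mkℚ ℤ.-[1+ k ] d _) (*<* ())

  half-exists : ∀ n → ∃[ m ] recip m + recip m ≤ recip n
  half-exists n = m , ≤-trans (+-mono-≤ le le)
    (≤-reflexive (trans (sym (*-distribʳ-+ (recip n) ½ ½)) (*-identityˡ (recip n))))
    where
    halved = archimedean (½ * recip n)
      (subst (_< ½ * recip n) (*-zeroʳ ½) (*-monoʳ-<-pos ½ (recip-positive n)))
    m  = proj₁ halved
    le = proj₂ halved

  abstract
    half : ℕ → ℕ
    half n = proj₁ (half-exists n)

    half+half : ∀ n → recip (half n) + recip (half n) ≤ recip n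
    half+half n = proj₂ (half-exists n)

  ε : ℕ → ℚ
  ε zero    = 1ℚ
  ε (suc k) = ¼ * ε k

  ε-positive : ∀ k → 0ℚ < ε k
  ε-positive zero    = *<* (ℤ.+<+ (s≤s z≤n))
  ε-positive (suc k) = subst (_< ¼ * ε k) (*-zeroʳ ¼) (*-monoʳ-<-pos ¼ (ε-positive k))

  ε-decreasing : ∀ k → ε (suc k) < ε k
  ε-decreasing k = subst (¼ * ε k <_) (*-identityˡ (ε k))
    (*-monoˡ-<-pos (ε k) {{ℚ.positive (ε-positive k)}} {¼} {1ℚ} (*<* (ℤ.+<+ (s≤s (s≤s z≤n)))))

  ε-≤1 : ∀ k → ε k ≤ 1ℚ
  ε-≤1 zero    = ≤-refl
  ε-≤1 (suc k) = ≤-trans (<⇒≤ (ε-decreasing k)) (ε-≤1 k)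

  ε-≤-recip : ∀ k → ε k ≤ recip k
  ε-≤-recip zero    = ≤-refl
  ε-≤-recip (suc k) = ≤-trans (*-monoˡ-≤-nonNeg ¼ (ε-≤-recip k)) quarter
    where
    quarter : ¼ * recip k ≤ recip (suc k)
    quarter = toℚᵘ-cancel-≤ (ℚᵘₚ.≤-trans
      (ℚᵘₚ.≤-reflexive (ℚᵘₚ.≃-trans (toℚᵘ-homo-* ¼ (recip k)) (ℚᵘₚ.*-congˡ {toℚᵘ ¼} (toℚᵘ-recip k))))
      (ℚᵘₚ.≤-trans (ℚᵘ.*≤* (ℤ.+≤+ bound))
      (ℚᵘₚ.≤-reflexive (ℚᵘₚ.≃-sym (toℚᵘ-recip (suc k))))))
      where
      bound : suc (suc k) ℕ.+ 0 ℕ.≤ suc (k ℕ.+ 3 ℕ.* suc k ℕ.+ 0)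
      bound = s≤s (ℕₚ.+-monoˡ-≤ 0 (ℕₚ.≤-trans (ℕₚ.≤-reflexive (ℕₚ.+-comm 1 k))
        (ℕₚ.+-monoʳ-≤ k {1} {3 ℕ.* suc k} (s≤s z≤n))))

  digit : Bool → ℚ
  digit true  = ¾
  digit false = 0ℚ

  -- Truncated base-four expansions with digits 0 and 3, all lying in the unit interval.
  partial : Pt → ℕ → ℚ
  partial t zero    = 0ℚ
  partial t (suc n) = digit (t 0) + ¼ * partial (t ∘ suc) n

  0≤partial : ∀ t n → 0ℚ ≤ partial t n
  0≤partial t zero    = ≤-refl
  0≤partial t (suc n) = +-mono-≤ (0≤digit (t 0))
    (subst (_≤ ¼ * partial (t ∘ suc) n) (*-zeroʳ ¼) (*-monoˡ-≤-nonNeg ¼ (0≤partial (t ∘ suc) n)))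
    where
    0≤digit : ∀ b → 0ℚ ≤ digit b
    0≤digit true  = ℚ.*≤* (ℤ.+≤+ z≤n)
    0≤digit false = ≤-refl

  partial≤1 : ∀ t n → partial t n ≤ 1ℚ
  partial≤1 t zero    = <⇒≤ (ε-positive 0)
  partial≤1 t (suc n) = +-mono-≤ (digit≤¾ (t 0)) (*-monoˡ-≤-nonNeg ¼ (partial≤1 (t ∘ suc) n))
    where
    digit≤¾ : ∀ b → digit b ≤ ¾
    digit≤¾ true  = ≤-refl
    digit≤¾ false = ℚ.*≤* (ℤ.+≤+ z≤n)

  partial-bounds : ∀ t t′ m m′ → - 1ℚ ≤ partial t m - partial t′ m′ × partial t m - partial t′ m′ ≤ 1ℚ
  partial-bounds t t′ m m′ =
    +-mono-≤ {0ℚ} (0≤partial t m) (neg-antimono-≤ (partial≤1 t′ m′)) ,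
    +-mono-≤ {_} {1ℚ} {_} {0ℚ} (partial≤1 t m) (neg-antimono-≤ (0≤partial t′ m′))

  same-digit : ∀ d x y → ∣ (d + ¼ * x) - (d + ¼ * y) ∣ ≡ ¼ * ∣ x - y ∣
  same-digit d x y = trans
    (cong ∣_∣ (solve 4 (λ c d x y → (d :+ c :* x) :- (d :+ c :* y) := c :* (x :- y)) refl ¼ d x y))
    (∣¼∗∣ (x - y))

  -- Letting `m` and `m′` differ covers both the Cauchy condition and continuity in `t`.
  partial-close : ∀ k t t′ {m m′} → k ℕ.≤ m → k ℕ.≤ m′ → (∀ i → i ℕ.< k → t i ≡ t′ i) →
                  ∣ partial t m - partial t′ m′ ∣ ≤ ε k
  partial-close zero    t t′ {m} {m′} _ _ _ =
    let (lower , upper) = partial-bounds t t′ m m′ in ∣∣-≤ lower upper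
  partial-close (suc k) t t′ {suc m} {suc m′} (s≤s k≤m) (s≤s k≤m′) agree
    rewrite agree 0 (s≤s z≤n) = ≤-trans
      (≤-reflexive (same-digit (digit (t′ 0)) (partial (t ∘ suc) m) (partial (t′ ∘ suc) m′)))
      (*-monoˡ-≤-nonNeg ¼ (partial-close k (t ∘ suc) (t′ ∘ suc) k≤m k≤m′ λ i i<k → agree (suc i) (s≤s i<k)))

  different-digits : ∀ x y → - 1ℚ ≤ x - y → ¼ ≤ ∣ (¾ + ¼ * x) - (0ℚ + ¼ * y) ∣
  different-digits x y -1≤ = ≤-trans
    (≤-trans (ℚ.*≤* (ℤ.+≤+ (s≤s (s≤s z≤n))))
    (≤-trans (+-monoʳ-≤ ¾ {¼ * - 1ℚ} (*-monoˡ-≤-nonNeg ¼ -1≤))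
    (≤-reflexive (solve 5 (λ a c o x y → a :+ c :* (x :- y) := (a :+ c :* x) :- (con 0ℚ :+ c :* y)) refl ¾ ¼ 0ℚ x y))))
    (≤-∣∣ _)

  -- Equal leading digits cancel and leave a factor ¼. At the first unequal ones the distance is at
  -- least ¾ - ¼, because the remaining sums differ by at most 1 and are scaled by ¼.
  partial-far : ∀ k t t′ {m} → k ℕ.≤ m → ∀ i → i ℕ.< k → t i ≢ t′ i →
                ε k ≤ ∣ partial t m - partial t′ m ∣
  partial-far (suc k) t t′ {suc m} (s≤s k≤m) zero _ ne with t 0 | t′ 0
  ... | true  | true  = ⊥-elim (ne refl)
  ... | false | false = ⊥-elim (ne refl)
  ... | true  | false = ≤-trans (*-monoˡ-≤-nonNeg ¼ (ε-≤1 k))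
    (different-digits (partial (t ∘ suc) m) _ (proj₁ (partial-bounds (t ∘ suc) (t′ ∘ suc) m m)))
  ... | false | true  = ≤-trans (*-monoˡ-≤-nonNeg ¼ (ε-≤1 k)) (≤-trans
    (different-digits (partial (t′ ∘ suc) m) _ (proj₁ (partial-bounds (t′ ∘ suc) (t ∘ suc) m m)))
    (≤-reflexive (∣-∣-sym (¾ + ¼ * partial (t′ ∘ suc) m) (0ℚ + ¼ * partial (t ∘ suc) m))))
  partial-far (suc k) t t′ {suc m} (s≤s k≤m) (suc i) (s≤s i<k) ne with t 0 ≟ᵇ t′ 0
  ... | no ne₀ = partial-far (suc k) t t′ (s≤s k≤m) zero (s≤s z≤n) ne₀
  ... | yes eq rewrite eq = ≤-trans
    (*-monoˡ-≤-nonNeg ¼ (partial-far k (t ∘ suc) (t′ ∘ suc) k≤m i i<k ne))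
    (≤-reflexive (sym (same-digit (digit (t′ 0)) (partial (t ∘ suc) m) (partial (t′ ∘ suc) m))))

  open Space ℝ-space public using () renaming (Near to Nearᴿ; _∼_ to _∼ᴿ_)
  open ℝ

  -- Wrapped so that unification never unfolds the rational 1 / (n + 1).
  record Closeᴿ (n : ℕ) (x y : ℝ) : Set where
    constructor close
    field
      near : Nearᴿ n x y

  open Closeᴿ

  ∼⇒close : ∀ n x y → x ∼ᴿ y → Closeᴿ n x y
  ∼⇒close n x y x∼y = close (x∼y n)

  close-refl : ∀ {n x} → Closeᴿ n x x
  close-refl {n} {x} = close (0ℚ , recip-positive n , 0 , λ m _ → ∣-∣-diagonal (approx x m))

  close-sym : ∀ {n x y} → Closeᴿ n x y → Closeᴿ n y x
  close-sym {n} {x} {y} (close (δ , δ< , N , bound)) = close (δ , δ< , N , λ m N≤m →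
    ≤-trans (≤-reflexive (∣-∣-sym (approx y m) (approx x m))) (bound m N≤m))

  close-trans : ∀ {n x y z} → Closeᴿ (half n) x y → Closeᴿ (half n) y z → Closeᴿ n x z
  close-trans {n} {x} {y} {z} (close (δ , δ< , N , bound)) (close (δ′ , δ′< , N′ , bound′)) = close
    (δ + δ′ , <-≤-trans (+-mono-< δ< δ′<) (half+half n) , N ℕ.⊔ N′ , λ m N≤m →
    ≤-trans (∣-∣-triangle (approx x m) (approx y m) (approx z m))
      (+-mono-≤ (bound m (ℕₚ.≤-trans (ℕₚ.m≤m⊔n N N′) N≤m)) (bound′ m (ℕₚ.≤-trans (ℕₚ.m≤n⊔m N N′) N≤m))))

  close-anti : ∀ {m n x y} → m ℕ.≤ n → Closeᴿ n x y → Closeᴿ m x y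
  close-anti m≤n (close (δ , δ< , rest)) = close (δ , <-≤-trans δ< (recip-anti m≤n) , rest)

  cantor : Pt → ℝ
  cantor t = record
    { approx = partial t
    ; cauchy = λ ε′ 0<ε′ →
        let (k , recip≤) = archimedean ε′ 0<ε′ in suc k , λ m n k≤m k≤n →
        ≤-<-trans (partial-close (suc k) t t k≤m k≤n λ _ _ → refl)
          (<-≤-trans (ε-decreasing k) (≤-trans (ε-≤-recip k) recip≤))
    }

  cantor-continuous : ∀ n {t t′} → hist t (suc n) ≡ hist t′ (suc n) → Closeᴿ n (cantor t) (cantor t′)
  cantor-continuous n {t} {t′} eq = close (ε (suc n) , <-≤-trans (ε-decreasing n) (ε-≤-recip n) , suc n , λ m n<m →
    partial-close (suc n) t t′ n<m n<m (hist-injective (suc n) eq))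

  -- Points that differ before `k` keep distance at least `ε k`. This uniform continuity of the
  -- inverse takes the place of compactness in showing that `Body` is closed.
  cantor-separates : ∀ k → ∃[ n ] (∀ {t t′} → Closeᴿ n (cantor t) (cantor t′) → hist t k ≡ hist t′ k)
  cantor-separates k = n , λ {t} {t′} near → hist-cong k λ i i<k → agree near i i<k
    where
    n = proj₁ (archimedean (ε k) (ε-positive k))
    agree : ∀ {t t′} → Closeᴿ n (cantor t) (cantor t′) → ∀ i → i ℕ.< k → t i ≡ t′ i
    agree {t} {t′} (close (δ , δ< , N , bound)) i i<k with t i ≟ᵇ t′ i
    ... | yes eq = eq
    ... | no ne  = ⊥-elim (<-irrefl refl (<-≤-trans δ< (≤-trans (proj₂ (archimedean (ε k) (ε-positive k)))
      (≤-trans (partial-far k t t′ (ℕₚ.m≤m⊔n k N) i i<k ne) (bound (k ℕ.⊔ N) (ℕₚ.m≤n⊔m k N))))))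

  -- By `grow`, the entry of `lim g y` just after the node `g · hist y n` is `y n`, and the nodes of
  -- one level have bounded length.
  lim-separates : ∀ g n → ∃[ k ] (∀ {y y′} → hist (lim g y) k ≡ hist (lim g y′) k → hist y n ≡ hist y′ n)
  lim-separates g zero = 0 , λ _ → refl
  lim-separates g (suc n) with lim-separates g n
    | uniform-bound n {λ u i → length (g · u) ℕ.≤ i} (λ i≤j le → ℕₚ.≤-trans le i≤j) (λ u _ → _ , ℕₚ.≤-refl)
  ... | k , separates | l , bound = k ℕ.⊔ suc l , λ {y} {y′} eq → cong₂ _∷_
    (top eq (separates (hist-restrict (ℕₚ.m≤m⊔n k (suc l)) eq)))
    (separates (hist-restrict (ℕₚ.m≤m⊔n k (suc l)) eq))
    where
    value : ∀ y → hist (lim g y) (suc (length (g · hist y n))) ≡ y n ∷ g · hist y n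
    value y = hist-suffix (length (g · hist y (suc n)))
      (⊒-trans (⊒-reflexive (hist-lim g y (suc n))) (grow g (y n) (hist y n)))
    top : ∀ {y y′} → hist (lim g y) (k ℕ.⊔ suc l) ≡ hist (lim g y′) (k ℕ.⊔ suc l) →
          hist y n ≡ hist y′ n → y n ≡ y′ n
    top {y} {y′} eq same = proj₁ (∷-injective (begin
      y n ∷ g · hist y n                                 ≡⟨ sym (value y) ⟩
      hist (lim g y) (suc (length (g · hist y n)))       ≡⟨ hist-restrict within eq ⟩
      hist (lim g y′) (suc (length (g · hist y n)))      ≡⟨ cong (λ u → hist (lim g y′) (suc (length (g · u)))) same ⟩
      hist (lim g y′) (suc (length (g · hist y′ n)))     ≡⟨ value y′ ⟩
      y′ n ∷ g · hist y′ n                               ∎))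
      where
      open ≡-Reasoning
      within : suc (length (g · hist y n)) ℕ.≤ k ℕ.⊔ suc l
      within = ℕₚ.≤-trans (s≤s (bound (hist y n) (hist-length y n))) (ℕₚ.m≤n⊔m k (suc l))

  lim-continuous : ∀ g n {y y′} → hist y n ≡ hist y′ n → hist (lim g y) n ≡ hist (lim g y′) n
  lim-continuous g n {y} {y′} eq = hist-restrict (hist-long g y n) (begin
    hist (lim g y) (length (g · hist y n))    ≡⟨ hist-lim g y n ⟩
    g · hist y n                              ≡⟨ cong (g ·_) eq ⟩
    g · hist y′ n                             ≡⟨ sym (hist-lim g y′ n) ⟩
    hist (lim g y′) (length (g · hist y′ n))  ≡⟨ cong (λ u → hist (lim g y′) (length (g · u))) (sym eq) ⟩
    hist (lim g y′) (length (g · hist y n))   ∎)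
    where open ≡-Reasoning

  module PerfectSet (g : Tree) where

    point : Pt → ℝ
    point y = cantor (lim g y)

    Body : Pred ℝ 0ℓ
    Body z = ∃[ y ] point y ∼ᴿ z

    continuous : ∀ n {y y′} → hist y (suc n) ≡ hist y′ (suc n) → Closeᴿ n (point y) (point y′)
    continuous n eq = cantor-continuous n (lim-continuous g (suc n) eq)

    separates : ∀ k → ∃[ n ] (∀ {y y′} → Closeᴿ n (point y) (point y′) → hist y k ≡ hist y′ k)
    separates k with lim-separates g k
    ... | l , lim-sep with cantor-separates l
    ... | n , sep = n , λ near → lim-sep (sep near)

    body-satisfiable : Satisfiable Body
    body-satisfiable = point (λ _ → false) , (λ _ → false) , λ n → near (close-refl {n} {point λ _ → false})

    noIsolatedPoints : NoIsolatedPoints ℝ-space Body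
    noIsolatedPoints z (y , y∼z) n = point y′ , (y′ , λ m → near (close-refl {m} {point y′})) ,
      near (close-trans {n} {z} {point y} {point y′} (close-sym (∼⇒close (half n) (point y) z y∼z))
        (continuous (half n) (hist-cong k λ i i<k → sym (unchanged i i<k)))) ,
      λ z∼y′ → flipped (sym (proj₁ (∷-injective (proj₂ (separates (suc k)) {y} {y′}
        (close-trans (∼⇒close _ (point y) z y∼z) (∼⇒close _ z (point y′) z∼y′))))))
      where
      k : ℕ
      k = suc (half n)
      -- One digit is flipped, beyond the first `k`, which determine the point up to precision
      -- `half n`.
      y′ : Pt
      y′ i with i ℕₚ.≟ k
      ... | yes _ = not (y i)
      ... | no  _ = y i
      unchanged : ∀ i → i ℕ.< k → y′ i ≡ y i
      unchanged i i<k with i ℕₚ.≟ k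
      ... | yes i≡k = ⊥-elim (ℕₚ.<-irrefl i≡k i<k)
      ... | no  _   = refl
      flipped : y′ k ≢ y k
      flipped with k ℕₚ.≟ k
      ... | yes _ = λ eq → not-¬ refl (sym eq)
      ... | no ne = ⊥-elim (ne refl)

    closed : Closed ℝ-space Body
    closed z limit = y , λ n → near (y-close n)
      where
      approximant : ∀ n → ∃[ x ] Closeᴿ n z (point x)
      approximant n with limit (half n)
      ... | w , (x , x∼w) , z≈w = x , close-trans (close z≈w) (close-sym (∼⇒close (half n) (point x) w x∼w))

      resolution : ℕ → ℕ
      resolution k = half (proj₁ (separates k))

      -- Increasing in `k`, at least `k`, and fine enough that two points this close to `z` share
      -- their first `k` digits.
      precision : ℕ → ℕ
      precision zero    = resolution 0
      precision (suc k) = (precision k ℕ.⊔ resolution (suc k)) ℕ.⊔ suc k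

      precision-mono : ∀ {j k} → j ℕ.≤ k → precision j ℕ.≤ precision k
      precision-mono {j} {zero} z≤n = ℕₚ.≤-refl
      precision-mono {j} {suc k} j≤1+k with ℕₚ.m≤n⇒m<n∨m≡n j≤1+k
      ... | inj₂ refl      = ℕₚ.≤-refl
      ... | inj₁ (s≤s j≤k) = ℕₚ.≤-trans (precision-mono j≤k)
        (ℕₚ.≤-trans (ℕₚ.m≤m⊔n _ (resolution (suc k))) (ℕₚ.m≤m⊔n _ (suc k)))

      resolution≤ : ∀ k → resolution k ℕ.≤ precision k
      resolution≤ zero    = ℕₚ.≤-refl
      resolution≤ (suc k) = ℕₚ.≤-trans (ℕₚ.m≤n⊔m (precision k) _) (ℕₚ.m≤m⊔n _ (suc k))

      k≤precision : ∀ k → k ℕ.≤ precision k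
      k≤precision zero    = z≤n
      k≤precision (suc k) = ℕₚ.m≤n⊔m _ (suc k)

      x : ℕ → Pt
      x k = proj₁ (approximant (precision k))

      close-x : ∀ k {n} → n ℕ.≤ precision k → Closeᴿ n z (point (x k))
      close-x k n≤ = close-anti n≤ (proj₂ (approximant (precision k)))

      coherent : ∀ {j k} → j ℕ.≤ k → hist (x j) j ≡ hist (x k) j
      coherent {j} {k} j≤k = proj₂ (separates j) (close-trans
        (close-sym (close-x j (resolution≤ j)))
        (close-x k (ℕₚ.≤-trans (resolution≤ j) (precision-mono j≤k))))

      y : Pt
      -- By `coherent`, the digit at `i` no longer changes from `x (suc i)` on.
      y i = x (suc i) i

      y-hist : ∀ k → hist y k ≡ hist (x k) k
      y-hist k = hist-cong k λ i i<k → hist-injective (suc i) (coherent i<k) i ℕₚ.≤-refl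

      y-close : ∀ n → Closeᴿ n (point y) z
      y-close n = close-trans (continuous (half n) (y-hist k))
        (close-sym (close-x k (ℕₚ.≤-trans (ℕₚ.n≤1+n (half n)) (k≤precision k))))
        where
        k : ℕ
        k = suc (half n)

    perfect : Perfect ℝ-space Body
    perfect = closed , noIsolatedPoints

-- From the coded games back to block sequences

module Codes where
  open import Data.Nat.Base using (_⊔_)
  open import Data.Nat.Properties using (≤-refl; m≤m⊔n; m≤n⊔m)
  open ≡ using (refl; sym; trans; cong; cong₂; subst)
  open Combinatorics
  open VectorSpaces
  open RealLine

  -- Strategies receive the moves oldest first, histories keep them newest first.
  hist-applyUpTo : {A : Set} (f : ℕ → A) (k : ℕ) → reverse (applyUpTo f k) ≡ hist f k
  hist-applyUpTo f zero    = refl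
  hist-applyUpTo f (suc k) = trans (cong reverse (sym (applyUpTo-∷ʳ f k)))
    (trans (reverse-++ (applyUpTo f k) (f k ∷ [])) (cong (f k ∷_) (hist-applyUpTo f k)))

  module Assembly (em : ExcludedMiddle 0ℓ) {F : CommutativeRing 0ℓ 0ℓ} (isField : IsField F)
    (countable : Countable F) (E : Module F 0ℓ 0ℓ) {e : ℕ → Module.Carrierᴹ E} (basis : IsBasis E e) where

    open Module E using (Carrierᴹ; _≈ᴹ_; 0ᴹ; ≈ᴹ-refl; ≈ᴹ-sym; ≈ᴹ-trans; ≈ᴹ-reflexive)
    open CommutativeRing F using () renaming (trans to ≈-trans)
    open BlockSequences E basis
    open BlockSubspaces em isField countable E basis
    open LinearAlgebra E using (IsSubmodule; ∈-span)
    open Least em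

    -- The least code depends on the vector only up to `≈ᴹ`, so strategies that read codes respect
    -- `≈ᴹ`.
    canonical : Carrierᴹ → ℕ
    canonical v = proj₁ (least (vec-onto v))

    vec-canonical : ∀ v → vec (canonical v) ≈ᴹ v
    vec-canonical v = proj₁ (proj₂ (least (vec-onto v)))

    canonical-cong : ∀ {v w} → v ≈ᴹ w → canonical v ≡ canonical w
    canonical-cong {v} {w} eq = least-unique (λ _ p → ≈ᴹ-trans p eq) (λ _ p → ≈ᴹ-trans p (≈ᴹ-sym eq))
      (proj₂ (least (vec-onto v))) (proj₂ (least (vec-onto w)))

    -- W : ℕ → ℕ stands for the sequence vec ∘ W.
    record Coded (A : Pred (ℝ × E^[∞]) 0ℓ) : Set₁ where
      field
        Hit        : (ℕ → ℕ) → Pt → (ℕ → ℕ) → Set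
        Hit-closed : ∀ β t W →
          (∀ n → Σ[ β′ ∈ (ℕ → ℕ) ] Σ[ t′ ∈ Pt ] Σ[ W′ ∈ (ℕ → ℕ) ]
            (hist β′ n ≡ hist β n × hist t′ n ≡ hist t n × hist W′ n ≡ hist W n × Hit β′ t′ W′)) →
          Hit β t W
        A⇒Hit : ∀ {t r Y W} → cantor t ∼ᴿ r → (∀ k → vec (W k) ≈ᴹ term Y k) → A (r , Y) → ∃[ β ] Hit β t W
        Hit⇒A : ∀ {β t r W} → cantor t ∼ᴿ r → Hit β t W →
                Σ[ Z ∈ E^[∞] ] ((∀ k → term Z k ≈ᴹ vec (W k)) × A (r , Z))

    analytic⇒coded : ∀ {A} → Analytic (ℝ-space ×ₛ E^[∞]-space) A → Coded A
    analytic⇒coded (inj₁ empty) = record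
      { Hit        = λ _ _ _ → ⊥
      ; Hit-closed = λ _ _ _ limit → proj₂ (proj₂ (proj₂ (proj₂ (proj₂ (proj₂ (limit 0))))))
      ; A⇒Hit      = λ _ _ a → ⊥-elim (empty _ a)
      ; Hit⇒A      = λ _ ()
      }
    analytic⇒coded {A} (inj₂ (f , f-continuous , A⇔)) = record
      { Hit        = Hit
      ; Hit-closed = λ β t W limit → (λ n → Closeᴿ.near (close-limit β t W limit n)) , term-limit β t W limit
      ; A⇒Hit      = A⇒Hit
      ; Hit⇒A      = Hit⇒A
      }
      where
      -- Phrased through `f β` rather than `A`, so that continuity of `f` makes it closed. A
      -- sequence that is hit is a block sequence because `proj₂ (f β)` is one.
      Hit : (ℕ → ℕ) → Pt → (ℕ → ℕ) → Set
      Hit β t W = proj₁ (f β) ∼ᴿ cantor t × (∀ k → term (proj₂ (f β)) k ≈ᴹ vec (W k))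

      Approximable : (ℕ → ℕ) → Pt → (ℕ → ℕ) → Set
      Approximable β t W = ∀ n → Σ[ β′ ∈ (ℕ → ℕ) ] Σ[ t′ ∈ Pt ] Σ[ W′ ∈ (ℕ → ℕ) ]
        (hist β′ n ≡ hist β n × hist t′ n ≡ hist t n × hist W′ n ≡ hist W n × Hit β′ t′ W′)

      close-limit : ∀ β t W → Approximable β t W → ∀ n → Closeᴿ n (proj₁ (f β)) (cantor t)
      close-limit β t W limit n with f-continuous β (half n)
      ... | k , near-k with limit (k ⊔ suc (half (half n)))
      ... | β′ , t′ , W′ , β-eq , t-eq , _ , (fβ′∼t′ , _) = close-trans
        (close (proj₁ (near-k β′ λ i i<k →
          hist-injective k (hist-restrict (m≤m⊔n k _) (sym β-eq)) i i<k)))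
        (close-trans (∼⇒close (half (half n)) (proj₁ (f β′)) (cantor t′) fβ′∼t′)
          (cantor-continuous (half (half n)) (hist-restrict (m≤n⊔m k _) t-eq)))

      term-limit : ∀ β t W → Approximable β t W → ∀ n → term (proj₂ (f β)) n ≈ᴹ vec (W n)
      term-limit β t W limit n with f-continuous β (suc n)
      ... | k , near-k with limit (k ⊔ suc n)
      ... | β′ , t′ , W′ , β-eq , _ , W-eq , (_ , terms) = ≈ᴹ-trans
        (proj₂ (near-k β′ λ i i<k →
          hist-injective k (hist-restrict (m≤m⊔n k _) (sym β-eq)) i i<k) n ≤-refl)
        (≈ᴹ-trans (terms n) (≈ᴹ-reflexive (cong vec
          (hist-injective (suc n) (hist-restrict (m≤n⊔m k (suc n)) W-eq) n ≤-refl))))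

      ∼ᴿ-trans : ∀ {x y z} → x ∼ᴿ y → y ∼ᴿ z → x ∼ᴿ z
      ∼ᴿ-trans {x} {y} {z} x∼y y∼z n = Closeᴿ.near
        (close-trans (∼⇒close (half n) x y x∼y) (∼⇒close (half n) y z y∼z))

      ∼ᴿ-sym : ∀ {x y} → x ∼ᴿ y → y ∼ᴿ x
      ∼ᴿ-sym {x} {y} x∼y n = Closeᴿ.near (close-sym (∼⇒close n x y x∼y))

      A⇒Hit : ∀ {t r Y W} → cantor t ∼ᴿ r → (∀ k → vec (W k) ≈ᴹ term Y k) → A (r , Y) → ∃[ β ] Hit β t W
      A⇒Hit {t} {r} {Y} {W} t∼r W≈Y a with Equivalence.to (A⇔ (r , Y)) a
      ... | β , fβ∼ = β , ∼ᴿ-trans {proj₁ (f β)} {r} {cantor t} (λ n → proj₁ (fβ∼ n)) (∼ᴿ-sym {cantor t} {r} t∼r) ,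
        λ k → ≈ᴹ-trans (proj₂ (fβ∼ (suc k)) k ≤-refl) (≈ᴹ-sym (W≈Y k))

      Hit⇒A : ∀ {β t r W} → cantor t ∼ᴿ r → Hit β t W →
              Σ[ Z ∈ E^[∞] ] ((∀ k → term Z k ≈ᴹ vec (W k)) × A (r , Z))
      Hit⇒A {β} {t} {r} {W} t∼r (fβ∼t , terms) = proj₂ (f β) , terms ,
        Equivalence.from (A⇔ (r , proj₂ (f β))) (β , λ n →
          ∼ᴿ-trans {proj₁ (f β)} {cantor t} {r} fβ∼t t∼r n , λ _ _ → ≈ᴹ-refl)

    <min-supp-cong : ∀ {n v w} → v ≈ᴹ w → n <min-supp v → n <min-supp w
    <min-supp-cong eq n<v i i∈w = n<v i λ z → i∈w (≈-trans (coefficient-cong (≈ᴹ-sym eq) i) z)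

    asymptoticStrategy : (List ℕ → ℕ) → StrategyI
    asymptoticStrategy ν = record
      { to   = λ ys → ν (reverse (map canonical ys))
      ; cong = λ eq → cong (ν ∘ reverse) (map-canonical eq)
      }
      where
      map-canonical : ∀ {xs ys} → Pointwise _≈ᴹ_ xs ys → map canonical xs ≡ map canonical ys
      map-canonical []         = refl
      map-canonical (eq ∷ eqs) = cong₂ _∷_ (canonical-cong eq) (map-canonical eqs)

    asymptoticStrategy-hist : ∀ ν (y : ℕ → Carrierᴹ) k →
      Func.to (asymptoticStrategy ν) (applyUpTo y k) ≡ ν (hist (canonical ∘ y) k)
    asymptoticStrategy-hist ν y k = cong ν
      (trans (cong reverse (map-applyUpTo y canonical k)) (hist-applyUpTo (canonical ∘ y) k))

    module Outcome {A : Pred (ℝ × E^[∞]) 0ℓ} (coded : Coded A) where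
      open Coded coded
      open AnalyticGame em blockSpace Hit Hit-closed

      avoids⇒strategyI : ∀ g X ν → Avoids ([] , []) ν g X →
        ∀ t Y → PerfectSet.Body g t → [ asymptoticStrategy ν ] X Y → ¬ A (t , Y)
      avoids⇒strategyI g X ν avoids t Y (y , y∼t) outcome a
        with A⇒Hit {W = canonical ∘ term Y} y∼t (λ k → vec-canonical (term Y k)) a
      ... | β , hit = avoids y (canonical ∘ term Y) β (refl , refl)
        (λ k _ → IsSubmodule.respects (⟨⟩-isSubmodule X) (≈ᴹ-sym (vec-canonical (term Y k))) (proj₁ (outcome k)) ,
          <min-supp-cong (≈ᴹ-sym (vec-canonical (term Y k)))
            (subst (_<min-supp term Y k) (asymptoticStrategy-hist ν (term Y) k) (proj₂ (outcome k))))
        hit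

      module FromForcing {X t} (forcing : Forcing X t) where
        open Forcing forcing
        open GowersStrategy em blockSpace Live start extend

        -- A strategy is shown only I's moves, so the states are recovered by replaying them.
        answers : State → List E^[∞] → Carrierᴹ
        -- II answers only after a move of I; this value makes the function total.
        answers q []           = 0ᴹ
        answers q (Z ∷ [])     = vec (proj₁ (respond q Z))
        answers q (Z ∷ Y ∷ Zs) = answers (proj₂ (respond q Z)) (Y ∷ Zs)

        ⊆-cong : ∀ {Y Z} → (∀ n → term Y n ≈ᴹ term Z n) → Y ⪯ Z
        ⊆-cong {Y} {Z} eq = IsSubmodule.span-⊆ (⟨⟩-isSubmodule Z) λ n →
          IsSubmodule.respects (⟨⟩-isSubmodule Z) (≈ᴹ-sym (eq n)) (∈-span (term Z) n)

        answers-cong : ∀ q {Ys Zs} → Pointwise (λ Y Z → ∀ n → term Y n ≈ᴹ term Z n) Ys Zs →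
                       answers q Ys ≈ᴹ answers q Zs
        answers-cong q [] = ≈ᴹ-refl
        answers-cong q {Y ∷ []} {Z ∷ []} (eq ∷ []) = ≈ᴹ-reflexive (cong (vec ∘ proj₁)
          (respond-cong q {Y} {Z} (⊆-cong {Y} {Z} eq) (⊆-cong {Z} {Y} λ n → ≈ᴹ-sym (eq n))))
        answers-cong q {Y ∷ Y′ ∷ Ys} {Z ∷ Z′ ∷ Zs} (eq ∷ eqs) = ≈ᴹ-trans
          (answers-cong (proj₂ (respond q Y)) eqs)
          (≈ᴹ-reflexive (cong (λ r → answers (proj₂ r) (Z′ ∷ Zs))
            (respond-cong q {Y} {Z} (⊆-cong {Y} {Z} eq) (⊆-cong {Z} {Y} λ n → ≈ᴹ-sym (eq n)))))

        strategy : StrategyII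
        strategy = record { to = answers initial ; cong = answers-cong initial }

        -- `answers` consumes I's moves from the front, while `run` recurs on the last one.
        run-shift : ∀ q Y k → run (proj₂ (respond q (Y 0))) (Y ∘ suc) k ≡ run q Y (suc k)
        run-shift q Y zero    = refl
        run-shift q Y (suc k) = cong (λ q′ → proj₂ (respond q′ (Y (suc k)))) (run-shift q Y k)

        answers-run : ∀ q Y k → answers q (applyUpTo Y (suc k)) ≡ vec (proj₁ (respond (run q Y k) (Y k)))
        answers-run q Y zero    = refl
        answers-run q Y (suc k) = trans (answers-run (proj₂ (respond q (Y 0))) (Y ∘ suc) k)
          (cong (λ q′ → vec (proj₁ (respond q′ (Y (suc k))))) (run-shift q Y k))

        strategy-wins : ∀ {r} → cantor t ∼ᴿ r → PlaysInto X strategy (λ Y → A (r , Y))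
        strategy-wins t∼r Y Y⪯X with Hit⇒A t∼r (wins out witness recurrent)
          where open Play Y (λ k → Y⪯X k)
        ... | Z , terms , a = Z ,
          (λ k → ≈ᴹ-trans (terms k) (≈ᴹ-reflexive (sym (answers-run initial Y k)))) ,
          (λ k → IsSubmodule.respects (⟨⟩-isSubmodule (Y k)) (≈ᴹ-sym (terms k)) (Play.out-∈ Y (λ k → Y⪯X k) k)) ,
          a

      dichotomy : Σ[ P ∈ Pred ℝ 0ℓ ] (Satisfiable P × Perfect ℝ-space P ×
        (Σ[ X ∈ E^[∞] ]
          ((Σ[ σ ∈ StrategyI ] (∀ t Y → P t → [ σ ] X Y → ¬ A (t , Y)))
           ⊎ (∀ t → P t → Σ[ τ ∈ StrategyII ] PlaysInto X τ (λ Y → A (t , Y))))))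
      dichotomy with analyticDichotomy basisSequence
      ... | inj₁ (g , X , _ , ν , avoids) =
        Body , body-satisfiable , perfect , X , inj₁ (asymptoticStrategy ν , avoids⇒strategyI g X ν avoids)
        where open PerfectSet g
      ... | inj₂ (g , X , _ , forcing) =
        Body , body-satisfiable , perfect , X , inj₂ λ { t (y , y∼t) →
          FromForcing.strategy (forcing y) , FromForcing.strategy-wins (forcing y) y∼t }
        where open PerfectSet g

theorem1p7 : (∀ {ℓ} → ExcludedMiddle ℓ) →
    (F : CommutativeRing 0ℓ 0ℓ) → IsField F → Countable F →
    (E : Module F 0ℓ 0ℓ) (e : ℕ → Module.Carrierᴹ E) (basis : IsBasis E e) →
    let open BlockSequences E basis in
    (A : Pred (ℝ × E^[∞]) 0ℓ) → Analytic (ℝ-space ×ₛ E^[∞]-space) A →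
    Σ[ P ∈ Pred ℝ 0ℓ ] (Satisfiable P × Perfect ℝ-space P ×
    (Σ[ X ∈ E^[∞] ]
    ((Σ[ σ ∈ StrategyI ] (∀ t Y → P t → [ σ ] X Y → ¬ A (t , Y)))
    ⊎ (∀ t → P t → Σ[ τ ∈ StrategyII ] PlaysInto X τ (λ Y → A (t , Y))))))
theorem1p7 em F isField countable E e basis A analytic = Outcome.dichotomy (analytic⇒coded analytic)
  where open Codes.Assembly em isField countable E basis
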